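{- Let $D$ be an oriented graph missing $3$ disjoint stars whose centers form a directed triangle in $D$, and let $\Delta$ be the dependency digraph of $D$. If $\Delta$ has neither a source nor a sink and $D$ has no sink, then $D$ has at least two vertices with the second neighborhood property, that is, there are at least two distinct vertices $v\in V(D)$ with $d^+_D(v)\le d^{++}_D(v)$.
   Context: All digraphs are finite. An oriented graph is a digraph without loops and without digons (directed cycles of length two). Write $x\rightarrow y$ if $(x,y)$ is an arc. $N^+(v)$ is the set of out-neighbors of $v$ and $N^{++}(v)$ is the set of vertices at distance exactly $2$ from $v$ (reached from $v$ by a directed path of length 2 but not by one of length 0 or 1); $d^+(v)=|N^+(v)|$, $d^{++}(v)=|N^{++}(v)|$. In any digraph, a sink is a vertex of out-degree $0$ and a source is a vertex of in-degree $0$. For distinct vertices $x,y$ of $D$, $xy$ is a missing edge if neither $(x,y)$ nor $(y,x)$ is an arc of $D$. The missing graph of $D$ is the graph whose edges are the missing edges of $D$ and whose vertices are the vertices of $D$ that are not adjacent to all other vertices. A star of center $x$ is a graph whose edge set has the form $\{a_ix : i=1,\dots,k\}$ with $k\ge 1$, the $a_i$ distinct and different from $x$ (when $k=1$, one of the two endpoints is designated as center). $D$ is missing 3 disjoint stars if its missing graph is the union of three pairwise vertex-disjoint stars. The centers $x,y,z$ of the stars form a directed triangle if the subdigraph of $D$ induced by $\{x,y,z\}$ is a directed cycle of length $3$. Dependency digraph: for missing edges $e$ and $e'$ of $D$, $e$ loses to $e'$ if the endpoints can be named $e=x_1y_1$, $e'=x_2y_2$ so that $x_1\rightarrow x_2$,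 $y_2\notin N^+(x_1)\cup N^{++}(x_1)$, $y_1\rightarrow y_2$ and $x_2\notin N^+(y_1)\cup N^{++}(y_1)$. The dependency digraph $\Delta$ of $D$ has the missing edges of $D$ as vertices, and an arc $(e,e')$ whenever $e$ loses to $e'$ (digons in $\Delta$ are allowed). -}

module Defs where

open import Data.Fin using (Fin; _≟_)
open import Data.Fin.Properties using (any?)
open import Data.Fin.Subset using (Subset; _∈_; _∉_; _∪_; ⁅_⁆; ∣_∣; Nonempty)
open import Data.Nat using (ℕ; _≤_)
open import Data.Product using (_×_; _,_; ∃; ∃₂; proj₁; proj₂)
open import Data.Sum as Sum using (_⊎_; inj₁; inj₂)
open import Data.Vec using (tabulate)
open import Function using (_∘_)
open import Level using (0ℓ)
open import Relation.Binary.Core as Binary using (Rel)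
open import Relation.Binary.Definitions as Binary
  using (Symmetric; Asymmetric; Irreflexive)
open import Relation.Binary.PropositionalEquality using (_≡_; _≢_; refl; sym; subst)
open import Relation.Nullary using (¬_; does; ¬?; _×-dec_)
open import Relation.Unary as Unary using (Pred; _≐_)

-- The vertices are the elements of A satisfying Vertex.

record Digraph (A : Set) : Set₁ where
  field
    Vertex   : Pred A 0ℓ
    Arc      : Rel A 0ℓ
    incident : ∀ {x y} → Arc x y → Vertex x × Vertex y

  -- Out-degree (respectively in-degree) 0, phrased without counting.

  IsSink : Pred A 0ℓ
  IsSink x = Vertex x × (∀ y → ¬ Arc x y)

  IsSource : Pred A 0ℓ
  IsSource x = Vertex x × (∀ y → ¬ Arc y x)

record Graph (A : Set) : Set₁ where
  field
    Vertex     : Pred A 0ℓ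
    Edge       : Rel A 0ℓ
    incident   : ∀ {x y} → Edge x y → Vertex x
    symmetric  : Symmetric Edge
    loopless   : Irreflexive _≡_ Edge

module _ {A : Set} where
  open Graph

  infixr 6 _∪ᴳ_
  infix  4 _≈ᴳ_

  _∪ᴳ_ : Graph A → Graph A → Graph A
  G ∪ᴳ H = record
    { Vertex    = Vertex G Unary.∪ Vertex H
    ; Edge      = λ x y → Edge G x y ⊎ Edge H x y
    ; incident  = Sum.map (incident G) (incident H)
    ; symmetric = Sum.map (symmetric G) (symmetric H)
    ; loopless  = λ eq → Sum.[ loopless G eq , loopless H eq ]
    }

  _≈ᴳ_ : Graph A → Graph A → Set
  G ≈ᴳ H = (Vertex G ≐ Vertex H) × (Edge G Binary.⇔ Edge H)

  VertexDisjoint : Graph A → Graph A → Set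
  VertexDisjoint G H = Vertex G Unary.⊥ Vertex H

-- The leaves a₁, …, aₖ (distinct, k ≥ 1) are given by the set they form.

record Star (n : ℕ) : Set where
  field
    center        : Fin n
    leaves        : Subset n
    nonempty      : Nonempty leaves
    center∉leaves : center ∉ leaves

  graph : Graph (Fin n)
  graph = record
    { Vertex    = λ v → v ≡ center ⊎ v ∈ leaves
    ; Edge      = λ u v → (u ≡ center × v ∈ leaves) ⊎ (v ≡ center × u ∈ leaves)
    ; incident  = Sum.map proj₁ proj₂
    ; symmetric = Sum.swap
    ; loopless  = λ { refl → Sum.[ notBoth , notBoth ] }
    }
    where
    notBoth : ∀ {v} → ¬ (v ≡ center × v ∈ leaves)
    notBoth (eq , v∈) = center∉leaves (subst (_∈ leaves) eq v∈)

⟦_⟧ : ∀ {n} {P : Pred (Fin n) 0ℓ} → Unary.Decidable P → Subset n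
⟦ P? ⟧ = tabulate (does ∘ P?)

record OrientedGraph (n : ℕ) : Set₁ where
  infix 4 _⟶_ _⟶?_
  field
    _⟶_      : Rel (Fin n) 0ℓ
    _⟶?_     : Binary.Decidable _⟶_
    loopless : Irreflexive _≡_ _⟶_
    noDigon  : Asymmetric _⟶_

  digraph : Digraph (Fin n)
  digraph = record { Vertex = Unary.U ; Arc = _⟶_ ; incident = _ }

  AtDistance2 : Rel (Fin n) 0ℓ
  AtDistance2 v w = w ≢ v × ¬ (v ⟶ w) × ∃ λ u → v ⟶ u × u ⟶ w

  atDistance2? : Binary.Decidable AtDistance2
  atDistance2? v w =
    ¬? (w ≟ v) ×-dec ¬? (v ⟶? w) ×-dec any? (λ u → (v ⟶? u) ×-dec (u ⟶? w))

  N⁺ N⁺⁺ : Fin n → Subset n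
  N⁺  v = ⟦ v ⟶?_ ⟧
  N⁺⁺ v = ⟦ atDistance2? v ⟧

  d⁺ d⁺⁺ : Fin n → ℕ
  d⁺  v = ∣ N⁺ v ∣
  d⁺⁺ v = ∣ N⁺⁺ v ∣

  SecondNeighborhoodProperty : Pred (Fin n) 0ℓ
  SecondNeighborhoodProperty v = d⁺ v ≤ d⁺⁺ v

  -- With loops and digons excluded, the arcs below are the only ones among
  -- x, y, z, and these three vertices are distinct.

  DirectedTriangle : Fin n → Fin n → Fin n → Set
  DirectedTriangle x y z =
    (x ⟶ y × y ⟶ z × z ⟶ x) ⊎ (x ⟶ z × z ⟶ y × y ⟶ x)

  Missing : Rel (Fin n) 0ℓ
  Missing x y = x ≢ y × ¬ (x ⟶ y) × ¬ (y ⟶ x)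

  missingGraph : Graph (Fin n)
  missingGraph = record
    { Vertex    = λ v → ¬ (∀ w → w ≢ v → v ⟶ w ⊎ w ⟶ v)
    ; Edge      = Missing
    ; incident  = λ { (x≢y , x↛y , y↛x) adjacent →
                      Sum.[ x↛y , y↛x ] (adjacent _ (x≢y ∘ sym)) }
    ; symmetric = λ { (x≢y , x↛y , y↛x) → x≢y ∘ sym , y↛x , x↛y }
    ; loopless  = λ x≡y (x≢y , _) → x≢y x≡y
    }

  -- Missing edges as vertices of the dependency digraph are unordered pairs,
  -- encoded as sets of endpoints.

  IsMissingEdge : Pred (Subset n) 0ℓ
  IsMissingEdge e = ∃₂ λ x y → Missing x y × e ≡ ⁅ x ⁆ ∪ ⁅ y ⁆

  record LosesTo (e e′ : Subset n) : Set where
    field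
      isMissing  : IsMissingEdge e
      isMissing′ : IsMissingEdge e′
      x₁ y₁ x₂ y₂ : Fin n
      e≡x₁y₁  : e ≡ ⁅ x₁ ⁆ ∪ ⁅ y₁ ⁆
      e′≡x₂y₂ : e′ ≡ ⁅ x₂ ⁆ ∪ ⁅ y₂ ⁆
      x₁⟶x₂   : x₁ ⟶ x₂
      y₂∉     : y₂ ∉ N⁺ x₁ ∪ N⁺⁺ x₁
      y₁⟶y₂   : y₁ ⟶ y₂
      x₂∉     : x₂ ∉ N⁺ y₁ ∪ N⁺⁺ y₁

  Δ : Digraph (Subset n)
  Δ = record
    { Vertex   = IsMissingEdge
    ; Arc      = LosesTo
    ; incident = λ l → LosesTo.isMissing l , LosesTo.isMissing′ l
    }

  record MissingThreeDisjointStars (S₁ S₂ S₃ : Star n) : Set where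
    open Star using (graph)
    field
      disjoint₁₂ : VertexDisjoint (graph S₁) (graph S₂)
      disjoint₁₃ : VertexDisjoint (graph S₁) (graph S₃)
      disjoint₂₃ : VertexDisjoint (graph S₂) (graph S₃)
      union      : missingGraph ≈ᴳ graph S₁ ∪ᴳ graph S₂ ∪ᴳ graph S₃

{-# OPTIONS --safe #-}

-- Let x ⟶ y ⟶ z ⟶ x be the centers and A, B, C the leaf sets. The only
-- possible losses are those of ax to by, by to cz and cz to ax; without sources
-- and sinks each missing edge loses to another one and is lost to. This
-- forces y ⟶ A ⟶ z, A ⟶ B ⟶ C ⟶ A and their rotations, and makes the union K of
-- the stars a module: a vertex outside K sees all of K in the same way.
-- Contract K to one vertex of weight |K|; the quotient is a weighted tournament.
-- By Havet and Thomassé, the last vertex of a median order has the (weighted)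
-- second neighbourhood property, and so has another vertex, found by
-- sedimentation, unless the first is a sink or is the heavy vertex. Light
-- vertices keep the property in D. If the heavy vertex has it, then, inside K,
-- z has it whenever |B| ≤ |C|, and so does any a that has it in the tournament
-- on A; up to rotation |B| ≤ |C| may be assumed. Existence of a median order is
-- only double negated, which suffices since the conclusion is decidable.
module Submission where

open import Defs
open import Data.Bool using (if_then_else_)
open import Data.Fin using (Fin; zero; suc; _≟_)
open import Data.Fin.Properties using () renaming (any? to anyFin?)
open import Data.Fin.Subset using (Subset; inside; outside; ∣_∣; ⁅_⁆; _∪_)
  renaming (_∈_ to _∈ˢ_; _∉_ to _∉ˢ_)
open import Data.Fin.Subset.Properties
  using (x∈⁅x⁆; x∈⁅y⁆⇒x≡y; x∈p∪q⁻; x∈p∪q⁺; ∣⁅x⁆∣≡1; p⊆q⇒∣p∣≤∣q∣; ∪-comm; _∈?_)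
open import Data.List
  using (List; []; _∷_; [_]; _++_; length; map; initLast; _∷ʳ′_; filter; allFin; tabulate)
open import Data.List.Properties using (++-assoc; map-++; ++-identityʳ; length-++)
open import Data.List.Membership.Propositional using (_∈_; find)
open import Data.List.Membership.Propositional.Properties
  using (∈-∃++; ∈-++⁺ʳ; ∈-allFin; ∈-filter⁺; ∈-filter⁻)
open import Data.List.Relation.Binary.Permutation.Propositional
  using (_↭_; ↭-refl; ↭-sym; ↭-trans; ↭⇒↭ₛ)
open import Data.List.Relation.Binary.Permutation.Propositional.Properties
  using (map⁺; ++⁺ˡ; shift; Any-resp-↭; ∈-resp-↭)
open import Data.List.Relation.Binary.Permutation.Setoid.Properties using (AllPairs-resp-↭)
open import Data.List.Relation.Ternary.Interleaving.Propositional
  using (Interleaving; []; consˡ; consʳ; toPermutation)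
open import Data.List.Relation.Unary.All as All using (All; []; _∷_)
import Data.List.Relation.Unary.All.Properties as All
open import Data.List.Relation.Unary.AllPairs using (AllPairs; []; _∷_)
open import Data.List.Relation.Unary.Any as Any using (Any; here; there; any?)
import Data.List.Relation.Unary.Any.Properties as Any
open import Data.List.Relation.Unary.Unique.Propositional using (Unique)
import Data.List.Relation.Unary.Unique.Propositional.Properties as Unique
open import Data.Nat
  using (ℕ; zero; suc; _+_; _*_; _≤_; _<_; z≤n; s≤s; s≤s⁻¹; _≤?_; >-nonZero)
open import Data.Nat.ListAction using (sum)
open import Data.Nat.ListAction.Properties using (sum-++; sum-↭)
open import Data.Nat.Properties hiding (_≟_)
open import Data.Nat.Solver using (module +-*-Solver)
open import Data.Product using (_×_; _,_; ∃; ∃₂; proj₁; proj₂)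
open import Data.Sum as Sum using (_⊎_; inj₁; inj₂)
import Data.Vec as Vec
open import Data.Vec using ([]; _∷_; here; there)
open import Data.Vec.Properties using (lookup∘tabulate; []=⇒lookup; lookup⇒[]=)
open import Function using (_∘_; id)
open import Level using (0ℓ)
open import Relation.Binary.Core using (Rel)
import Relation.Binary.Definitions as Binary
open import Relation.Binary.PropositionalEquality
  using (_≡_; _≢_; refl; sym; trans; cong; cong₂; subst; subst₂; resp₂; setoid; module ≡-Reasoning)
open import Relation.Nullary
  using (¬_; Dec; yes; no; does; contradiction; _×-dec_; _⊎-dec_; ¬?)
open import Relation.Nullary.Decidable using (decidable-stable; dec-true)
open import Relation.Unary using (Pred; Decidable)
open +-*-Solver using (solve; _:+_; _:*_; _:=_)

-- Indicators, weighted totals over lists, and maxima.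

𝟙 : {P : Set} → Dec P → ℕ
𝟙 P? = if does P? then 1 else 0

𝟙-true : {P : Set} (P? : Dec P) → P → 𝟙 P? ≡ 1
𝟙-true (yes _) _ = refl
𝟙-true (no ¬p) p = contradiction p ¬p

𝟙-false : {P : Set} (P? : Dec P) → ¬ P → 𝟙 P? ≡ 0
𝟙-false (yes p) ¬p = contradiction p ¬p
𝟙-false (no _)  _  = refl

𝟙≤1 : {P : Set} (P? : Dec P) → 𝟙 P? ≤ 1
𝟙≤1 (yes _) = ≤-refl
𝟙≤1 (no _)  = z≤n

𝟙-mono : {P Q : Set} (P? : Dec P) (Q? : Dec Q) → (P → Q) → 𝟙 P? ≤ 𝟙 Q?
𝟙-mono (yes p) Q? f = ≤-reflexive (sym (𝟙-true Q? (f p)))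
𝟙-mono (no _)  Q? f = z≤n

module _ {A : Set} where

  total : (A → ℕ) → List A → ℕ
  total g L = sum (map g L)

  total-++ : ∀ g X Y → total g (X ++ Y) ≡ total g X + total g Y
  total-++ g X Y = trans (cong sum (map-++ g X Y)) (sum-++ (map g X) (map g Y))

  total-↭ : ∀ g {X Y} → X ↭ Y → total g X ≡ total g Y
  total-↭ g = sum-↭ ∘ map⁺ g

  total-mono : ∀ {g h L} → All (λ v → g v ≤ h v) L → total g L ≤ total h L
  total-mono []       = z≤n
  total-mono (p ∷ ps) = +-mono-≤ p (total-mono ps)

  ∈⇒≤total : ∀ g {v L} → v ∈ L → g v ≤ total g L
  ∈⇒≤total g (here refl) = m≤m+n _ _
  ∈⇒≤total g (there v∈)  = ≤-trans (∈⇒≤total g v∈) (m≤n+m _ _)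

  -- For following a marked vertex through one sedimentation: it either joins the bad vertices or
  -- survives with no more vertices behind it than before. The length bound feeds the recursion in
  -- `second-SNP`.
  interleave-split : ∀ {l r Y : List A} {v} X → Interleaving l r (X ++ v ∷ Y) →
    v ∈ l ⊎ ∃₂ λ X′ Y′ → r ≡ X′ ++ v ∷ Y′ × length Y′ ≤ length Y
  interleave-split [] (consˡ i) = inj₁ (here refl)
  interleave-split [] (consʳ i) = inj₂ ([] , _ , refl , shorter i)
    where
    shorter : ∀ {l r L : List A} → Interleaving l r L → length r ≤ length L
    shorter []        = z≤n
    shorter (consˡ i) = m≤n⇒m≤1+n (shorter i)
    shorter (consʳ i) = s≤s (shorter i)
  interleave-split (_ ∷ X) (consˡ i) = Sum.map there id (interleave-split X i)
  interleave-split (u ∷ X) (consʳ i) with interleave-split X i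
  ... | inj₁ v∈l = inj₁ v∈l
  ... | inj₂ (X′ , Y′ , refl , le) = inj₂ (u ∷ X′ , Y′ , refl , le)

  -- An element that is not maximal yields one with strictly larger `h`, and `h` is bounded. In
  -- `search`, the fuel `k` bounds the increases still possible.
  ¬¬-maximum : ∀ {P : A → Set} (h : A → ℕ) b → (∀ {a} → P a → h a ≤ b) → ∃ P →
    ¬ ¬ ∃ λ a → P a × (∀ {a′} → P a′ → h a′ ≤ h a)
  ¬¬-maximum {P} h b bounded (a₀ , p₀) none = search b a₀ p₀ (m≤m+n b _)
    where
    search : ∀ k a → P a → ¬ (b ≤ k + h a)
    search zero    a p le = none (a , p , λ p′ → ≤-trans (bounded p′) le)
    search (suc k) a p le = none (a , p , top)
      where
      top : ∀ {a′} → P a′ → h a′ ≤ h a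
      top {a′} p′ with h a′ ≤? h a
      ... | yes ok = ok
      ... | no  gt = contradiction
        (≤-trans (≤-trans le (≤-reflexive (sym (+-suc k (h a))))) (+-monoʳ-≤ k (≰⇒> gt)))
        (search k a′ p′)

-- Weighted median orders and sedimentation.

module MedianOrder
  {V : Set} {_⟶_ : Rel V 0ℓ} (_⟶?_ : Binary.Decidable _⟶_) (asym : Binary.Asymmetric _⟶_)
  (ω : V → ℕ) (ω>0 : ∀ v → 0 < ω v)
  where

  Adjacent : Rel V 0ℓ
  Adjacent u v = u ⟶ v ⊎ v ⟶ u

  out inn : V → List V → ℕ
  out v = total λ u → 𝟙 (v ⟶? u) * ω u
  inn v = total λ u → 𝟙 (u ⟶? v) * ω u

  -- The weight of the forward arcs, where an arc counts with the product of the weights of its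
  -- ends. Median orders maximise it.
  value : List V → ℕ
  value []      = 0
  value (v ∷ L) = ω v * out v L + value L

  value-bound : ∀ L → value L ≤ total ω L * total ω L
  value-bound []      = z≤n
  value-bound (v ∷ L) = begin
    ω v * out v L + value L ≤⟨ +-mono-≤ (*-monoʳ-≤ (ω v) out≤) (value-bound L) ⟩
    ω v * T + T * T         ≡⟨ *-distribʳ-+ T (ω v) T ⟨
    (ω v + T) * T           ≤⟨ *-monoʳ-≤ (ω v + T) (m≤n+m T (ω v)) ⟩
    (ω v + T) * (ω v + T)   ∎
    where
    open ≤-Reasoning
    T = total ω L
    out≤ : out v L ≤ T
    out≤ = total-mono (All.universal (λ u →
      ≤-trans (*-monoˡ-≤ (ω u) (𝟙≤1 (v ⟶? u))) (≤-reflexive (+-identityʳ _))) L)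

  -- Moving `v` across `Y` affects only the arcs between `v` and `Y`: those into `v` stop being
  -- forward, those out of `v` become forward. Both amounts are added rather than subtracted to stay
  -- within ℕ.
  value-move : ∀ X Y v Z →
    value (X ++ Y ++ v ∷ Z) + ω v * out v Y ≡ value (X ++ v ∷ Y ++ Z) + ω v * inn v Y
  value-move [] [] v Z = refl
  value-move [] (y ∷ Y) v Z = begin
    ω y * out y (Y ++ v ∷ Z) + value (Y ++ v ∷ Z) + ω v * (α * ω y + out v Y)
      ≡⟨ cong (λ t → ω y * t + value (Y ++ v ∷ Z) + ω v * (α * ω y + out v Y)) outy ⟩
    ω y * (β * ω v + out y (Y ++ Z)) + value (Y ++ v ∷ Z) + ω v * (α * ω y + out v Y)
      ≡⟨ solve 7 (λ wy b wv o w a t →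
           wy :* (b :* wv :+ o) :+ w :+ wv :* (a :* wy :+ t) :=
           (w :+ wv :* t) :+ (wy :* o :+ wy :* b :* wv :+ wv :* (a :* wy))) refl
           (ω y) β (ω v) (out y (Y ++ Z)) (value (Y ++ v ∷ Z)) α (out v Y) ⟩
    (value (Y ++ v ∷ Z) + ω v * out v Y) + rest
      ≡⟨ cong (_+ rest) (value-move [] Y v Z) ⟩
    (ω v * out v (Y ++ Z) + value (Y ++ Z) + ω v * inn v Y) + rest
      ≡⟨ solve 8 (λ wv p w i wy o b a →
           (wv :* p :+ w :+ wv :* i) :+ (wy :* o :+ wy :* b :* wv :+ wv :* (a :* wy)) :=
           wv :* (a :* wy :+ p) :+ (wy :* o :+ w) :+ wv :* (b :* wy :+ i)) refl
           (ω v) (out v (Y ++ Z)) (value (Y ++ Z)) (inn v Y) (ω y) (out y (Y ++ Z)) β α ⟩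
    ω v * (α * ω y + out v (Y ++ Z)) + (ω y * out y (Y ++ Z) + value (Y ++ Z)) + ω v * (β * ω y + inn v Y) ∎
    where
    open ≡-Reasoning
    α = 𝟙 (v ⟶? y)
    β = 𝟙 (y ⟶? v)
    rest = ω y * out y (Y ++ Z) + ω y * β * ω v + ω v * (α * ω y)
    outy : out y (Y ++ v ∷ Z) ≡ β * ω v + out y (Y ++ Z)
    outy = total-↭ _ (shift v Y Z)
  value-move (x ∷ X) Y v Z = begin
    ω x * out x (X ++ Y ++ v ∷ Z) + value (X ++ Y ++ v ∷ Z) + ω v * out v Y
      ≡⟨ +-assoc (ω x * out x (X ++ Y ++ v ∷ Z)) _ _ ⟩
    ω x * out x (X ++ Y ++ v ∷ Z) + (value (X ++ Y ++ v ∷ Z) + ω v * out v Y)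
      ≡⟨ cong₂ (λ s t → ω x * s + t) (total-↭ _ (++⁺ˡ X (shift v Y Z))) (value-move X Y v Z) ⟩
    ω x * out x (X ++ v ∷ Y ++ Z) + (value (X ++ v ∷ Y ++ Z) + ω v * inn v Y)
      ≡⟨ +-assoc (ω x * out x (X ++ v ∷ Y ++ Z)) _ _ ⟨
    ω x * out x (X ++ v ∷ Y ++ Z) + value (X ++ v ∷ Y ++ Z) + ω v * inn v Y ∎
    where open ≡-Reasoning

  module _ (S : List V) (tournament : AllPairs Adjacent S) where

    Median : List V → Set
    Median L = L ↭ S × (∀ {L′} → L′ ↭ S → value L′ ≤ value L)

    ¬¬-median : ¬ ¬ ∃ Median
    ¬¬-median = ¬¬-maximum value (total ω S * total ω S)
      (λ {L} L↭S → subst (λ t → value L ≤ t * t) (total-↭ ω L↭S) (value-bound L))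
      (S , ↭-refl)

    -- The feedback property: moving `v` in front of `Y` cannot increase the value. Positivity of
    -- the weight allows `ω v` to be cancelled.
    median-out≤inn : ∀ X Y v Z → Median (X ++ Y ++ v ∷ Z) → out v Y ≤ inn v Y
    median-out≤inn X Y v Z (perm , max) = *-cancelˡ-≤ (ω v) {{>-nonZero (ω>0 v)}}
      (+-cancelˡ-≤ (value (X ++ v ∷ Y ++ Z)) _ _ (begin
        value (X ++ v ∷ Y ++ Z) + ω v * out v Y
          ≤⟨ +-monoˡ-≤ _ (max (↭-trans (++⁺ˡ X (↭-sym (shift v Y Z))) perm)) ⟩
        value (X ++ Y ++ v ∷ Z) + ω v * out v Y ≡⟨ value-move X Y v Z ⟩
        value (X ++ v ∷ Y ++ Z) + ω v * inn v Y ∎))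
      where open ≤-Reasoning

    -- The equality case of feedback: the move keeps the value, so the new order is again median.
    -- Sedimentation consists of such moves.
    median-move : ∀ X Y v Z → Median (X ++ Y ++ v ∷ Z) → out v Y ≡ inn v Y →
      Median (X ++ v ∷ Y ++ Z)
    median-move X Y v Z (perm , max) eq =
      ↭-trans (++⁺ˡ X (↭-sym (shift v Y Z))) perm ,
      λ p → ≤-trans (max p) (≤-reflexive (+-cancelʳ-≡ (ω v * inn v Y) _ _
        (trans (cong (λ t → value (X ++ Y ++ v ∷ Z) + ω v * t) (sym eq)) (value-move X Y v Z))))

    median-adjacent : ∀ X Y v Z → Median (X ++ Y ++ v ∷ Z) → All (Adjacent v) Y
    median-adjacent X Y v Z (perm , _) = go X Y
      (AllPairs-resp-↭ (setoid V) Sum.swap (resp₂ Adjacent) (↭⇒↭ₛ (↭-sym perm)) tournament)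
      where
      go : ∀ X Y → AllPairs Adjacent (X ++ Y ++ v ∷ Z) → All (Adjacent v) Y
      go (_ ∷ X) Y       (_ ∷ ps) = go X Y ps
      go []      []      _        = []
      go []      (y ∷ Y) (p ∷ ps) = Sum.swap (All.head (All.++⁻ʳ Y p)) ∷ go [] Y ps

    irrefl : ∀ {v} → ¬ (v ⟶ v)
    irrefl l = asym l l

    -- In a tournament the arc `u ⟶ v` does the work of both `u ≢ v` and the absence of `v ⟶ u`. The
    -- intermediate vertex may come from anywhere in `S`.
    Second : Rel V 0ℓ
    Second v u = u ⟶ v × Any (λ w → v ⟶ w × w ⟶ u) S

    second? : Binary.Decidable Second
    second? v u = (u ⟶? v) ×-dec any? (λ w → (v ⟶? w) ×-dec (w ⟶? u)) S

    sec : V → List V → ℕ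
    sec v = total λ u → 𝟙 (second? v u) * ω u

    -- Sedimentation: f moves to the front of the part of the order that it
    -- reaches within two steps, and the remaining ("bad") vertices B before it.
    data Outcome (f : V) (P J R Z : List V) : Set where
      strict   : out f (J ++ R) < sec f (J ++ R) → Outcome f P J R Z
      sediment : ∀ {B J′} → Interleaving B J′ R → All (_⟶ f) B →
                 Median (P ++ B ++ f ∷ (J ++ J′) ++ Z) →
                 out f (J ++ R) ≤ sec f (J ++ J′) → Outcome f P J R Z

    outcome⇒≤ : ∀ {f P J R Z} → Outcome f P J R Z → out f (J ++ R) ≤ sec f (J ++ R)
    outcome⇒≤ (strict lt) = <⇒≤ lt
    outcome⇒≤ {f} {J = J} {R} (sediment {B} {J′} i _ _ le) = ≤-trans le (begin
      sec f (J ++ J′)               ≡⟨ total-++ _ J J′ ⟩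
      sec f J + sec f J′            ≤⟨ +-monoʳ-≤ (sec f J) (m≤n+m _ (sec f B)) ⟩
      sec f J + (sec f B + sec f J′) ≡⟨ cong (sec f J +_) (total-++ _ B J′) ⟨
      sec f J + sec f (B ++ J′)     ≡⟨ cong (sec f J +_) (total-↭ _ (toPermutation i)) ⟨
      sec f J + sec f R             ≡⟨ total-++ _ J R ⟨
      sec f (J ++ R)                ∎)
      where open ≤-Reasoning

    -- Reads the vertices before `f` from left to right; those in `J` are already known to be within
    -- two steps of `f`, those in `R` are unread. A next vertex `r` that `f` does not reach through
    -- `J` is bad, and then out f J ≤ out r J ≤ inn r J ≤ sec f J, the middle inequality being
    -- feedback for `r`. Strictness there gives a surplus; equality lets `r` move in front of `J`
    -- and out of the way.
    scan : ∀ f P J R Z → Median (P ++ J ++ R ++ f ∷ Z) →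
      All (λ u → f ⟶ u ⊎ Second f u) J → Outcome f P J R Z
    -- With nothing unread, every in-neighbour of `f` in `J` is a second out-neighbour, so feedback
    -- for `f` itself against `J` decides between surplus and moving `f`.
    scan f P J [] Z med reached = finish (m≤n⇒m<n∨m≡n (median-out≤inn P J f Z med))
      where
      inn≤sec : inn f J ≤ sec f J
      inn≤sec = total-mono (All.map (λ {u} r → *-monoˡ-≤ (ω u) (𝟙-mono (u ⟶? f) (second? f u)
        λ u⟶f → Sum.[ (λ f⟶u → contradiction f⟶u (asym u⟶f)) , id ] r)) reached)
      finish : out f J < inn f J ⊎ out f J ≡ inn f J → Outcome f P J [] Z
      finish (inj₁ lt) = strict (subst (λ l → out f l < sec f l) (sym (++-identityʳ J))
        (≤-trans lt inn≤sec))
      finish (inj₂ eq) = sediment [] []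
        (subst (λ l → Median (P ++ f ∷ l ++ Z)) (sym (++-identityʳ J)) (median-move P J f Z med eq))
        (subst (λ l → out f l ≤ sec f l) (sym (++-identityʳ J)) (≤-trans (≤-reflexive eq) inn≤sec))
    scan f P J (r ∷ R) Z med reached = decide (f ⟶? r) (any? (λ u → (f ⟶? u) ×-dec (u ⟶? r)) J)
      where
      open ≤-Reasoning

      adjacent-f : All (Adjacent f) (J ++ r ∷ R)
      adjacent-f = median-adjacent P (J ++ r ∷ R) f Z
        (subst (λ l → Median (P ++ l)) (sym (++-assoc J (r ∷ R) _)) med)

      adjacent-r : All (Adjacent r) J
      adjacent-r = median-adjacent P J r _ med

      join : f ⟶ r ⊎ Second f r → Outcome f P J (r ∷ R) Z
      join q with scan f P (J ++ [ r ]) R Z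
        (subst (λ l → Median (P ++ l)) (sym (++-assoc J [ r ] _)) med)
        (All.++⁺ reached (q ∷ []))
      ... | strict lt = strict (subst (λ l → out f l < sec f l) (++-assoc J [ r ] R) lt)
      ... | sediment {B} {J′} i b med′ le = sediment (consʳ i) b
        (subst (λ l → Median (P ++ B ++ f ∷ l ++ Z)) (++-assoc J [ r ] J′) med′)
        (subst₂ (λ l l′ → out f l ≤ sec f l′) (++-assoc J [ r ] R) (++-assoc J [ r ] J′) le)

      decide : Dec (f ⟶ r) → Dec (Any (λ u → f ⟶ u × u ⟶ r) J) → Outcome f P J (r ∷ R) Z
      decide (yes f⟶r) _         = join (inj₁ f⟶r)
      decide (no f↛r)  (yes via) = join (inj₂
        ( Sum.[ (λ l → contradiction l f↛r) , id ] (All.lookup adjacent-f (∈-++⁺ʳ J (here refl)))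
        , Any-resp-↭ (proj₁ med) (Any.++⁺ʳ P (Any.++⁺ˡ via))))
      decide (no f↛r)  (no bad) = compare (m≤n⇒m<n∨m≡n (median-out≤inn P J r _ med))
        where
        r⟶f : r ⟶ f
        r⟶f = Sum.[ (λ l → contradiction l f↛r) , id ] (All.lookup adjacent-f (∈-++⁺ʳ J (here refl)))

        -- An out-neighbour of `f` in `J` with an arc into `r` would be the path that a bad `r`
        -- lacks.
        outf≤outr : out f J ≤ out r J
        outf≤outr = total-mono (All.tabulate λ {u} u∈ → *-monoˡ-≤ (ω u)
          (𝟙-mono (f ⟶? u) (r ⟶? u) λ f⟶u → Sum.[ id
            , (λ u⟶r → contradiction (Any.map (λ { refl → f⟶u , u⟶r }) u∈) bad) ]
            (All.lookup adjacent-r u∈)))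

        -- For the same reason an in-neighbour of `r` in `J` is not an out-neighbour of `f`, so the
        -- invariant `reached` leaves only `Second`.
        innr≤secf : inn r J ≤ sec f J
        innr≤secf = total-mono (All.tabulate λ {u} u∈ → *-monoˡ-≤ (ω u)
          (𝟙-mono (u ⟶? r) (second? f u) λ u⟶r → Sum.[
              (λ f⟶u → contradiction (Any.map (λ { refl → f⟶u , u⟶r }) u∈) bad) , id ]
            (All.lookup reached u∈)))

        compare : out r J < inn r J ⊎ out r J ≡ inn r J → Outcome f P J (r ∷ R) Z
        compare (inj₁ lt) = strict (begin-strict
          out f (J ++ r ∷ R)              ≡⟨ total-++ _ J (r ∷ R) ⟩
          out f J + (𝟙 (f ⟶? r) * ω r + out f R)
            ≡⟨ cong (λ t → out f J + (t * ω r + out f R)) (𝟙-false (f ⟶? r) f↛r) ⟩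
          out f J + out f R
            <⟨ +-mono-<-≤ (≤-<-trans outf≤outr (<-≤-trans lt innr≤secf)) rest ⟩
          sec f J + sec f R               ≤⟨ +-monoʳ-≤ (sec f J) (m≤n+m _ _) ⟩
          sec f J + sec f (r ∷ R)         ≡⟨ total-++ _ J (r ∷ R) ⟨
          sec f (J ++ r ∷ R)              ∎)
          where
          regroup : P ++ J ++ r ∷ R ++ f ∷ Z ≡ (P ++ J ++ [ r ]) ++ R ++ f ∷ Z
          regroup = trans (cong (P ++_) (sym (++-assoc J [ r ] _))) (sym (++-assoc P (J ++ [ r ]) _))
          -- The strict gain lies in `J`, so `R` has to contribute only the weak inequality; a fresh
          -- scan starting behind `r` gives it.
          rest : out f R ≤ sec f R
          rest = outcome⇒≤ (scan f (P ++ J ++ [ r ]) [] R Z (subst Median regroup med) [])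
        compare (inj₂ eq)
          with scan f (P ++ [ r ]) J R Z
            (subst Median (sym (++-assoc P [ r ] _)) (median-move P J r _ med eq)) reached
        ... | strict lt = strict (begin-strict
          out f (J ++ r ∷ R)      ≡⟨ total-↭ _ (shift r J R) ⟩
          𝟙 (f ⟶? r) * ω r + out f (J ++ R)
            ≡⟨ cong (λ t → t * ω r + out f (J ++ R)) (𝟙-false (f ⟶? r) f↛r) ⟩
          out f (J ++ R)          <⟨ lt ⟩
          sec f (J ++ R)          ≤⟨ m≤n+m _ _ ⟩
          sec f (r ∷ J ++ R)      ≡⟨ total-↭ _ (shift r J R) ⟨
          sec f (J ++ r ∷ R)      ∎)
        ... | sediment {B} {J′} i b med′ le = sediment (consˡ i) (r⟶f ∷ b)
          (subst Median (++-assoc P [ r ] _) med′) (begin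
          out f (J ++ r ∷ R)      ≡⟨ total-↭ _ (shift r J R) ⟩
          𝟙 (f ⟶? r) * ω r + out f (J ++ R)
            ≡⟨ cong (λ t → t * ω r + out f (J ++ R)) (𝟙-false (f ⟶? r) f↛r) ⟩
          out f (J ++ R)          ≤⟨ le ⟩
          sec f (J ++ J′)         ∎)

    SNP : V → Set
    SNP v = out v S ≤ sec v S

    out-split : ∀ {f M Z} → Median (M ++ f ∷ Z) → out f S ≡ out f M + out f Z
    out-split {f} {M} {Z} (perm , _) = trans (total-↭ _ (↭-sym perm))
      (trans (total-++ _ M (f ∷ Z))
        (cong (λ t → out f M + (t * ω f + out f Z)) (𝟙-false (f ⟶? f) irrefl)))

    sec-split : ∀ {f M Z} → Median (M ++ f ∷ Z) → sec f M ≤ sec f S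
    sec-split {f} {M} {Z} (perm , _) = ≤-trans (m≤m+n _ _)
      (≤-reflexive (trans (sym (total-++ _ M (f ∷ Z))) (total-↭ _ perm)))

    -- The theorem of Havet and Thomassé: no vertex follows `f`, so scanning everything before it
    -- accounts for all its out-neighbours.
    feed-SNP : ∀ M f → Median (M ++ [ f ]) → SNP f
    feed-SNP M f med = begin
      out f S     ≡⟨ out-split med ⟩
      out f M + 0 ≡⟨ +-identityʳ _ ⟩
      out f M     ≤⟨ outcome⇒≤ (scan f [] [] M [] med []) ⟩
      sec f M     ≤⟨ sec-split med ⟩
      sec f S     ∎
      where open ≤-Reasoning

    -- Feedback for the one-vertex block `[ y ]`: an arc `f ⟶ y` would be a backward arc of positive
    -- weight with nothing to balance it.
    predecessor : ∀ X y f → Median (X ++ y ∷ [ f ]) → y ⟶ f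
    predecessor X y f med with y ⟶? f | median-out≤inn X [ y ] f [] med
    ... | yes y⟶f | _  = y⟶f
    ... | no y↛f  | le with median-adjacent X [ y ] f [] med
    ...   | inj₂ y⟶f ∷ [] = y⟶f
    ...   | inj₁ f⟶y ∷ [] = contradiction (ω>0 y) (≤⇒≯ (begin
      ω y                       ≡⟨ *-identityˡ (ω y) ⟨
      1 * ω y                   ≡⟨ cong (_* ω y) (𝟙-true (f ⟶? y) f⟶y) ⟨
      𝟙 (f ⟶? y) * ω y          ≡⟨ +-identityʳ _ ⟨
      𝟙 (f ⟶? y) * ω y + 0      ≤⟨ le ⟩
      0                         ∎))
      where open ≤-Reasoning

    -- Sediment the order without its last vertex f. An out-neighbour x of f
    -- cannot precede f immediately, so after finitely many rounds either the
    -- feed y of the truncated order has a strict surplus or x is bad for y; as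
    -- y ⟶ f ⟶ x, both make up for the additional out-neighbour f of y.
    second-SNP : ∀ k X x Y f → length Y ≤ k → ω f ≡ 1 → f ⟶ x →
      Median ((X ++ x ∷ Y) ++ [ f ]) → ∃ λ y → y ≢ f × y ∈ S × SNP y
    second-SNP k X x Y f len ωf f⟶x med with initLast Y
    ... | [] = contradiction (predecessor X x f (subst Median (++-assoc X [ x ] [ f ]) med)) (asym f⟶x)
    second-SNP zero X x Y f len ωf f⟶x med | [] ∷ʳ′ y = contradiction len λ ()
    second-SNP zero X x Y f len ωf f⟶x med | (_ ∷ _) ∷ʳ′ y = contradiction len λ ()
    second-SNP (suc k) X x _ f len ωf f⟶x med | Y ∷ʳ′ y = conclude (scan y [] [] M [ f ] med′ [])
      where
      open ≤-Reasoning
      M = X ++ x ∷ Y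

      med′ : Median (M ++ y ∷ [ f ])
      med′ = subst Median (trans (cong (_++ [ f ]) (sym (++-assoc X (x ∷ Y) [ y ]))) (++-assoc M [ y ] [ f ])) med

      y⟶f : y ⟶ f
      y⟶f = predecessor M y f med′

      |Y|≤k : length Y ≤ k
      |Y|≤k = s≤s⁻¹ (≤-trans (≤-reflexive (sym (trans (length-++ Y) (+-comm (length Y) 1)))) len)

      y≢f : y ≢ f
      y≢f refl = irrefl y⟶f

      y∈S : y ∈ S
      y∈S = ∈-resp-↭ (proj₁ med′) (∈-++⁺ʳ M (here refl))

      f∈S : f ∈ S
      f∈S = ∈-resp-↭ (proj₁ med′) (∈-++⁺ʳ M (there (here refl)))

      -- Outside `M` the only out-neighbour of `y` is `f`, and the strict inequality pays for it
      -- exactly because `f` has weight 1.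
      surplus : out y M < sec y M → SNP y
      surplus lt = begin
        out y S                              ≡⟨ out-split med′ ⟩
        out y M + (𝟙 (y ⟶? f) * ω f + 0)     ≡⟨ cong₂ (λ s t → out y M + (s * t + 0)) (𝟙-true (y ⟶? f) y⟶f) ωf ⟩
        out y M + 1                          ≡⟨ +-comm _ 1 ⟩
        suc (out y M)                        ≤⟨ lt ⟩
        sec y M                              ≤⟨ sec-split med′ ⟩
        sec y S                              ∎

      conclude : Outcome y [] [] M [ f ] → ∃ λ y → y ≢ f × y ∈ S × SNP y
      conclude (strict lt) = y , y≢f , y∈S , surplus lt
      conclude (sediment {B} {J′} i b med″ le) with interleave-split X i
      -- The bound `le` counts no second out-neighbours in `B`; the bad vertex `x` is one, through
      -- `f`, which lies in `S` though not in `M`.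
      ... | inj₁ x∈B = y , y≢f , y∈S , surplus (begin-strict
        out y M            ≤⟨ le ⟩
        sec y J′           <⟨ +-monoˡ-≤ (sec y J′) (≤-trans x-counted (∈⇒≤total _ x∈B)) ⟩
        sec y B + sec y J′ ≡⟨ total-++ _ B J′ ⟨
        sec y (B ++ J′)    ≡⟨ total-↭ _ (toPermutation i) ⟨
        sec y M            ∎)
        where
        x-counted : 1 ≤ 𝟙 (second? y x) * ω x
        x-counted = begin
          1                       ≤⟨ ω>0 x ⟩
          ω x                     ≡⟨ *-identityˡ (ω x) ⟨
          1 * ω x                 ≡⟨ cong (_* ω x) (𝟙-true (second? y x)
                                       (All.lookup b x∈B , Any.map (λ { refl → y⟶f , f⟶x }) f∈S)) ⟨
          𝟙 (second? y x) * ω x   ∎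
      -- Now `y` has sunk to a place before `x`, so fewer vertices separate `x` from `f`, and the
      -- order is still median.
      ... | inj₂ (X′ , Y′ , refl , |Y′|≤|Y|) =
        second-SNP k (B ++ y ∷ X′) x Y′ f (≤-trans |Y′|≤|Y| |Y|≤k) ωf f⟶x
          (subst Median (trans (sym (++-assoc B (y ∷ X′ ++ x ∷ Y′) [ f ]))
            (cong (_++ [ f ]) (sym (++-assoc B (y ∷ X′) (x ∷ Y′))))) med″)

    ¬¬-feed : ∀ {u} → u ∈ S → ¬ ¬ ∃₂ λ M f → Median (M ++ [ f ]) × f ∈ S
    ¬¬-feed u∈S none = ¬¬-median λ (L , med) → last L med
      where
      last : ∀ L → ¬ Median L
      last L med with initLast L
      ... | []      = contradiction (∈-resp-↭ (↭-sym (proj₁ med)) u∈S) λ ()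
      ... | M ∷ʳ′ f = none (M , f , med , ∈-resp-↭ (proj₁ med) (∈-++⁺ʳ M (here refl)))

    ¬¬-SNP : ∀ {u} → u ∈ S → ¬ ¬ ∃ λ v → v ∈ S × SNP v
    ¬¬-SNP u∈S none = ¬¬-feed u∈S λ (M , f , med , f∈S) → none (f , f∈S , feed-SNP M f med)

    -- The first vertex is the feed; an out-neighbour of it serves as the `x` of `second-SNP`. The
    -- two provisos stay in the conclusion because the feed is not known in advance.
    ¬¬-two-SNP : ∀ {u} → u ∈ S → ¬ ¬ ∃ λ v → v ∈ S × SNP v ×
      (ω v ≡ 1 → Any (v ⟶_) S → ∃ λ w → w ≢ v × w ∈ S × SNP w)
    ¬¬-two-SNP u∈S none = ¬¬-feed u∈S λ (M , f , med , f∈S) →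
      none (f , f∈S , feed-SNP M f med , other M f med)
      where
      other : ∀ M f → Median (M ++ [ f ]) → ω f ≡ 1 → Any (f ⟶_) S →
        ∃ λ w → w ≢ f × w ∈ S × SNP w
      other M f med ωf f⟶S with Any.++⁻ M (Any-resp-↭ (↭-sym (proj₁ med)) f⟶S)
      ... | inj₂ (here f⟶f) = contradiction f⟶f irrefl
      ... | inj₁ f⟶M with find f⟶M
      ...   | x , x∈M , f⟶x with ∈-∃++ x∈M
      ...     | X , Y , refl = second-SNP (length Y) X x Y f ≤-refl ωf f⟶x med

-- From totals over lists to cardinalities of subsets.

𝟙-cong : {P Q : Set} (P? : Dec P) (Q? : Dec Q) → (P → Q) → (Q → P) → 𝟙 P? ≡ 𝟙 Q?
𝟙-cong P? Q? f g = ≤-antisym (𝟙-mono P? Q? f) (𝟙-mono Q? P? g)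

unique⇒allPairs : ∀ {A : Set} {R : Rel A 0ℓ} {Q : Pred A 0ℓ} {L} →
  (∀ {u v} → Q u → Q v → u ≢ v → R u v) → All Q L → Unique L → AllPairs R L
unique⇒allPairs r []       []       = []
unique⇒allPairs r (q ∷ qs) (u ∷ us) =
  All.zipWith (λ (q′ , u≢v) → r q q′ u≢v) (qs , u) ∷ unique⇒allPairs r qs us

module _ {n : ℕ} where

  ∈⟦⟧⁺ : {P : Pred (Fin n) 0ℓ} (P? : Decidable P) {v : Fin n} → P v → v ∈ˢ ⟦ P? ⟧
  ∈⟦⟧⁺ P? {v} p = lookup⇒[]= v _ (trans (lookup∘tabulate _ v) (dec-true (P? v) p))

  ∈⟦⟧⁻ : {P : Pred (Fin n) 0ℓ} (P? : Decidable P) {v : Fin n} → v ∈ˢ ⟦ P? ⟧ → P v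
  ∈⟦⟧⁻ P? {v} v∈ with P? v | trans (sym (lookup∘tabulate (does ∘ P?) v)) ([]=⇒lookup v∈)
  ... | yes p | _  = p
  ... | no _  | ()

  -- Translates the totals of `MedianOrder` into the cardinalities that define degrees. The map `f`
  -- is there for the induction, which replaces it by `f ∘ suc`; the uses take `id`.
  total-filter : ∀ {m} (f : Fin m → Fin n) {Q R : Pred (Fin n) 0ℓ}
    (Q? : Decidable Q) (R? : Decidable R) (g : Fin n → ℕ) →
    (∀ {v} → Q v → g v ≡ 𝟙 (R? v)) → (∀ {v} → R v → Q v) →
    total g (filter Q? (tabulate f)) ≡ ∣ Vec.tabulate (does ∘ R? ∘ f) ∣
  total-filter {zero}  f Q? R? g eq R⇒Q = refl
  total-filter {suc m} f Q? R? g eq R⇒Q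
    with Q? (f zero) | R? (f zero) | eq {f zero} | total-filter (f ∘ suc) Q? R? g eq R⇒Q
  ... | yes q | yes _ | e | ih = cong₂ _+_ (e q) ih
  ... | yes q | no _  | e | ih = cong₂ _+_ (e q) ih
  ... | no ¬q | yes r | _ | ih = contradiction (R⇒Q r) ¬q
  ... | no _  | no _  | _ | ih = ih

∣p∪q∣≤∣p∣+∣q∣ : ∀ {n} (p q : Subset n) → ∣ p ∪ q ∣ ≤ ∣ p ∣ + ∣ q ∣
∣p∪q∣≤∣p∣+∣q∣ []            []            = z≤n
∣p∪q∣≤∣p∣+∣q∣ (outside ∷ p) (outside ∷ q) = ∣p∪q∣≤∣p∣+∣q∣ p q
∣p∪q∣≤∣p∣+∣q∣ (outside ∷ p) (inside  ∷ q) rewrite +-suc ∣ p ∣ ∣ q ∣ = s≤s (∣p∪q∣≤∣p∣+∣q∣ p q)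
∣p∪q∣≤∣p∣+∣q∣ (inside  ∷ p) (outside ∷ q) = s≤s (∣p∪q∣≤∣p∣+∣q∣ p q)
∣p∪q∣≤∣p∣+∣q∣ (inside  ∷ p) (inside  ∷ q) rewrite +-suc ∣ p ∣ ∣ q ∣ = s≤s (m≤n⇒m≤1+n (∣p∪q∣≤∣p∣+∣q∣ p q))

disjoint⇒∣p∣+∣q∣≤∣p∪q∣ : ∀ {n} (p q : Subset n) → (∀ {v} → v ∈ˢ p → v ∉ˢ q) → ∣ p ∣ + ∣ q ∣ ≤ ∣ p ∪ q ∣
disjoint⇒∣p∣+∣q∣≤∣p∪q∣ []            []            d = z≤n
disjoint⇒∣p∣+∣q∣≤∣p∪q∣ (outside ∷ p) (outside ∷ q) d =
  disjoint⇒∣p∣+∣q∣≤∣p∪q∣ p q λ v∈p v∈q → d (there v∈p) (there v∈q)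
disjoint⇒∣p∣+∣q∣≤∣p∪q∣ (outside ∷ p) (inside  ∷ q) d rewrite +-suc ∣ p ∣ ∣ q ∣ =
  s≤s (disjoint⇒∣p∣+∣q∣≤∣p∪q∣ p q λ v∈p v∈q → d (there v∈p) (there v∈q))
disjoint⇒∣p∣+∣q∣≤∣p∪q∣ (inside  ∷ p) (outside ∷ q) d =
  s≤s (disjoint⇒∣p∣+∣q∣≤∣p∪q∣ p q λ v∈p v∈q → d (there v∈p) (there v∈q))
disjoint⇒∣p∣+∣q∣≤∣p∪q∣ (inside  ∷ p) (inside  ∷ q) d = contradiction here (d here)

module _ {n : ℕ} where

  -- Recovers the endpoints of a missing edge, up to order, from its encoding as a set: the distinct
  -- `a` and `x` cannot both be the same one of `p` and `q`.
  pair-≡ : ∀ {a x p q : Fin n} → a ≢ x → ⁅ p ⁆ ∪ ⁅ q ⁆ ≡ ⁅ a ⁆ ∪ ⁅ x ⁆ →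
    (p ≡ a × q ≡ x) ⊎ (p ≡ x × q ≡ a)
  pair-≡ {a} {x} {p} {q} a≢x eq with member a (inj₁ refl) | member x (inj₂ refl)
    where
    member : ∀ v → v ≡ a ⊎ v ≡ x → v ≡ p ⊎ v ≡ q
    member v v∈ = Sum.map (x∈⁅y⁆⇒x≡y p) (x∈⁅y⁆⇒x≡y q) (x∈p∪q⁻ ⁅ p ⁆ ⁅ q ⁆
      (subst (v ∈ˢ_) (sym eq) (x∈p∪q⁺ (Sum.map (λ { refl → x∈⁅x⁆ v }) (λ { refl → x∈⁅x⁆ v }) v∈))))
  ... | inj₁ a≡p | inj₁ x≡p = contradiction (trans a≡p (sym x≡p)) a≢x
  ... | inj₁ a≡p | inj₂ x≡q = inj₁ (sym a≡p , sym x≡q)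
  ... | inj₂ a≡q | inj₁ x≡p = inj₂ (sym x≡p , sym a≡q)
  ... | inj₂ a≡q | inj₂ x≡q = contradiction (trans a≡q (sym x≡q)) a≢x

-- Losses between missing edges and the arcs they force.

module _ {n : ℕ} (D : OrientedGraph n) where
  open OrientedGraph D
  open Star using (center; leaves; graph)

  irrefl : ∀ {v} → ¬ v ⟶ v
  irrefl v⟶v = noDigon v⟶v v⟶v

  Adj : Rel (Fin n) 0ℓ
  Adj u v = u ⟶ v ⊎ v ⟶ u

  adjacent : ∀ {u v} → u ≢ v → ¬ Missing u v → Adj u v
  adjacent {u} {v} u≢v ¬miss = decidable-stable ((u ⟶? v) ⊎-dec (v ⟶? u))
    λ ¬adj → ¬miss (u≢v , ¬adj ∘ inj₁ , ¬adj ∘ inj₂)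

  towards : ∀ {u v} → Adj u v → ¬ v ⟶ u → u ⟶ v
  towards adj v↛u = Sum.[ id , (λ v⟶u → contradiction v⟶u v↛u) ] adj

  Far : Rel (Fin n) 0ℓ
  Far v w = ¬ v ⟶ w × (∀ u → v ⟶ u → ¬ u ⟶ w)

  ∉⇒far : ∀ {v w} → w ∉ˢ N⁺ v ∪ N⁺⁺ v → Far v w
  ∉⇒far {v} {w} w∉ = v↛w , λ u v⟶u u⟶w →
    w∉ (x∈p∪q⁺ (inj₂ (∈⟦⟧⁺ (atDistance2? v) ((λ { refl → noDigon v⟶u u⟶w }) , v↛w , u , v⟶u , u⟶w))))
    where
    v↛w : ¬ v ⟶ w
    v↛w v⟶w = w∉ (x∈p∪q⁺ (inj₁ (∈⟦⟧⁺ (v ⟶?_) v⟶w)))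

  -- `Far` is purely negative. This matters because the absence of sinks and sources in `Δ` only
  -- refutes that no loss exists.
  far-stable : ∀ {v w} → ¬ ¬ Far v w → Far v w
  far-stable ¬¬far =
    (λ l → ¬¬far λ far → proj₁ far l) , λ u p q → ¬¬far λ far → proj₂ far u p q

  Loss : (u v s t : Fin n) → Set
  Loss u v s t = u ⟶ s × Far u t × v ⟶ t × Far v s

  -- `LosesTo` may name the endpoints of either edge in either order. Swapping both namings gives
  -- the same loss, so only two ways of matching the endpoints remain.
  losesTo⇒loss : ∀ {u v s t} → u ≢ v → s ≢ t → LosesTo (⁅ u ⁆ ∪ ⁅ v ⁆) (⁅ s ⁆ ∪ ⁅ t ⁆) →
    Loss u v s t ⊎ Loss u v t s
  losesTo⇒loss u≢v s≢t l
    with pair-≡ u≢v (sym (LosesTo.e≡x₁y₁ l)) | pair-≡ s≢t (sym (LosesTo.e′≡x₂y₂ l))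
  ... | inj₁ (refl , refl) | inj₁ (refl , refl) =
    inj₁ (LosesTo.x₁⟶x₂ l , ∉⇒far (LosesTo.y₂∉ l) , LosesTo.y₁⟶y₂ l , ∉⇒far (LosesTo.x₂∉ l))
  ... | inj₁ (refl , refl) | inj₂ (refl , refl) =
    inj₂ (LosesTo.x₁⟶x₂ l , ∉⇒far (LosesTo.y₂∉ l) , LosesTo.y₁⟶y₂ l , ∉⇒far (LosesTo.x₂∉ l))
  ... | inj₂ (refl , refl) | inj₁ (refl , refl) =
    inj₂ (LosesTo.y₁⟶y₂ l , ∉⇒far (LosesTo.x₂∉ l) , LosesTo.x₁⟶x₂ l , ∉⇒far (LosesTo.y₂∉ l))
  ... | inj₂ (refl , refl) | inj₂ (refl , refl) =
    inj₁ (LosesTo.y₁⟶y₂ l , ∉⇒far (LosesTo.x₂∉ l) , LosesTo.x₁⟶x₂ l , ∉⇒far (LosesTo.y₂∉ l))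

  InStar : Star n → Pred (Fin n) 0ℓ
  InStar S = Graph.Vertex (graph S)

  InStars : Star n → Star n → Star n → Pred (Fin n) 0ℓ
  InStars S₁ S₂ S₃ = Graph.Vertex (graph S₁ ∪ᴳ graph S₂ ∪ᴳ graph S₃)

  rotate-InStars : ∀ S₁ S₂ S₃ {v} → InStars S₁ S₂ S₃ v → InStars S₂ S₃ S₁ v
  rotate-InStars _ _ _ = Sum.[ inj₂ ∘ inj₂ , Sum.map id inj₁ ]

  unrotate-InStars : ∀ S₁ S₂ S₃ {v} → InStars S₂ S₃ S₁ v → InStars S₁ S₂ S₃ v
  unrotate-InStars _ _ _ = Sum.[ inj₂ ∘ inj₁ , Sum.[ inj₂ ∘ inj₂ , inj₁ ] ]

  inStars? : ∀ S₁ S₂ S₃ → Decidable (InStars S₁ S₂ S₃)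
  inStars? S₁ S₂ S₃ v = inStar? S₁ ⊎-dec inStar? S₂ ⊎-dec inStar? S₃
    where
    inStar? : ∀ S → Dec (InStar S v)
    inStar? S = (v ≟ center S) ⊎-dec (v ∈? leaves S)

  -- Throughout, x, y, z are the centers of S₁, S₂, S₃, and a, b, c range over
  -- their leaves; the other cases of each lemma are obtained by rotation.
  record Config (S₁ S₂ S₃ : Star n) : Set where
    field
      missing  : MissingThreeDisjointStars S₁ S₂ S₃
      x⟶y      : center S₁ ⟶ center S₂
      y⟶z      : center S₂ ⟶ center S₃
      z⟶x      : center S₃ ⟶ center S₁
      noSource : ∀ e → ¬ Digraph.IsSource Δ e
      noSink   : ∀ e → ¬ Digraph.IsSink Δ e

    open MissingThreeDisjointStars missing public

  rotate : ∀ {S₁ S₂ S₃} → Config S₁ S₂ S₃ → Config S₂ S₃ S₁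
  rotate cfg = record
    { missing = record
      { disjoint₁₂ = disjoint₂₃
      ; disjoint₁₃ = λ (p , q) → disjoint₁₂ (q , p)
      ; disjoint₂₃ = λ (p , q) → disjoint₁₃ (q , p)
      ; union = let (V⊆ , V⊇) , E⊆ , E⊇ = union in
          ( (λ v → Sum.[ inj₂ ∘ inj₂ , Sum.map id inj₁ ] (V⊆ v))
          , (λ v → V⊇ (Sum.[ inj₂ ∘ inj₁ , Sum.[ inj₂ ∘ inj₂ , inj₁ ] ] v)))
          , (λ e → Sum.[ inj₂ ∘ inj₂ , Sum.map id inj₁ ] (E⊆ e))
          , (λ e → E⊇ (Sum.[ inj₂ ∘ inj₁ , Sum.[ inj₂ ∘ inj₂ , inj₁ ] ] e))
      }
    ; x⟶y = y⟶z ; y⟶z = z⟶x ; z⟶x = x⟶y ; noSource = noSource ; noSink = noSink }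
    where open Config cfg

  module Cyclic {S₁ S₂ S₃ : Star n} (cfg : Config S₁ S₂ S₃) where
    open Config cfg
    x = center S₁
    y = center S₂
    z = center S₃

    IsEdgeOf : Star n → Pred (Subset n) 0ℓ
    IsEdgeOf S e = ∃ λ a → a ∈ˢ leaves S × e ≡ ⁅ a ⁆ ∪ ⁅ center S ⁆

    missing⇒edge : ∀ {u v} → Missing u v → Graph.Edge (graph S₁ ∪ᴳ graph S₂ ∪ᴳ graph S₃) u v
    missing⇒edge = proj₁ (proj₂ union)

    missingEdge⇒ : ∀ {e} → IsMissingEdge e → IsEdgeOf S₁ e ⊎ IsEdgeOf S₂ e ⊎ IsEdgeOf S₃ e
    missingEdge⇒ (u , v , miss , refl) =
      Sum.map (orient S₁) (Sum.map (orient S₂) (orient S₃)) (missing⇒edge miss)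
      where
      orient : ∀ S → Graph.Edge (graph S) u v → IsEdgeOf S (⁅ u ⁆ ∪ ⁅ v ⁆)
      orient S (inj₁ (refl , v∈)) = v , v∈ , ∪-comm _ _
      orient S (inj₂ (refl , u∈)) = u , u∈ , refl

    leaf-missing : ∀ {a} → a ∈ˢ leaves S₁ → Missing a x
    leaf-missing a∈ = proj₂ (proj₂ union) (inj₁ (inj₂ (refl , a∈)))

    leaf≢center : ∀ (S : Star n) {a} → a ∈ˢ leaves S → a ≢ center S
    leaf≢center S a∈ refl = Star.center∉leaves S a∈

    adjacent₁₂ : ∀ {u v} → InStar S₁ u → InStar S₂ v → Adj u v
    adjacent₁₂ {u} {v} u∈ v∈ = adjacent (λ { refl → disjoint₁₂ (u∈ , v∈) }) (other ∘ missing⇒edge)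
      where
      other : ¬ Graph.Edge (graph S₁ ∪ᴳ graph S₂ ∪ᴳ graph S₃) u v
      other (inj₁ e)        = disjoint₁₂ (Graph.incident (graph S₁) (Graph.symmetric (graph S₁) e) , v∈)
      other (inj₂ (inj₁ e)) = disjoint₁₂ (u∈ , Graph.incident (graph S₂) e)
      other (inj₂ (inj₂ e)) = disjoint₁₃ (u∈ , Graph.incident (graph S₃) e)

    adjacent-outside : ∀ {u v} → ¬ InStars S₁ S₂ S₃ v → u ≢ v → Adj u v
    adjacent-outside v∉ u≢v = adjacent u≢v λ miss →
      v∉ (Graph.incident G (Graph.symmetric G (missing⇒edge miss)))
      where G = graph S₁ ∪ᴳ graph S₂ ∪ᴳ graph S₃

    adjacent-leaves : ∀ {u v} → u ∈ˢ leaves S₁ → v ∈ˢ leaves S₁ → u ≢ v → Adj u v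
    adjacent-leaves {u} {v} u∈ v∈ u≢v = adjacent u≢v (other ∘ missing⇒edge)
      where
      other : ¬ Graph.Edge (graph S₁ ∪ᴳ graph S₂ ∪ᴳ graph S₃) u v
      other (inj₁ (inj₁ (refl , _))) = Star.center∉leaves S₁ u∈
      other (inj₁ (inj₂ (refl , _))) = Star.center∉leaves S₁ v∈
      other (inj₂ (inj₁ e)) = disjoint₁₂ (inj₂ u∈ , Graph.incident (graph S₂) e)
      other (inj₂ (inj₂ e)) = disjoint₁₃ (inj₂ u∈ , Graph.incident (graph S₃) e)

    -- As ax is not a sink of `Δ`, it loses to some edge. Edges at `x` would need a loop or an arc
    -- between `a` and `x`; edges at `z` conflict with `z ⟶ x` or with the path x ⟶ y ⟶ z. For by,
    -- matching `x` with `y` is the only option, and it includes `Far a y`.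
    far-a-y : ∀ {a} → a ∈ˢ leaves S₁ → Far a y
    far-a-y {a} a∈ = far-stable λ ¬far →
      noSink (⁅ a ⁆ ∪ ⁅ x ⁆) ((a , x , leaf-missing a∈ , refl) , λ e l → ¬far (lose l (missingEdge⇒ (LosesTo.isMissing′ l))))
      where
      a≢x : a ≢ x
      a≢x = leaf≢center S₁ a∈
      lose : ∀ {e} → LosesTo (⁅ a ⁆ ∪ ⁅ x ⁆) e → IsEdgeOf S₁ e ⊎ IsEdgeOf S₂ e ⊎ IsEdgeOf S₃ e → Far a y
      lose l (inj₁ (a′ , a′∈ , refl)) with losesTo⇒loss a≢x (leaf≢center S₁ a′∈) l
      ... | inj₁ (_ , _ , x⟶x , _) = contradiction x⟶x irrefl
      ... | inj₂ (a⟶x , _)         = contradiction a⟶x (proj₁ (proj₂ (leaf-missing a∈)))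
      lose l (inj₂ (inj₁ (b , b∈ , refl))) with losesTo⇒loss a≢x (leaf≢center S₂ b∈) l
      ... | inj₁ (_ , far , _)     = far
      ... | inj₂ (_ , _ , _ , far) = contradiction x⟶y (proj₁ far)
      lose l (inj₂ (inj₂ (c , c∈ , refl))) with losesTo⇒loss a≢x (leaf≢center S₃ c∈) l
      ... | inj₁ (_ , _ , x⟶z , _) = contradiction z⟶x (noDigon x⟶z)
      ... | inj₂ (_ , _ , _ , far) = contradiction y⟶z (proj₂ far y x⟶y)

    -- Dually, ax is not a source, and the triangle leaves only an edge cz, with `c` matched to `a`
    -- and `z` to `x`, that can lose to it.
    far-z-a : ∀ {a} → a ∈ˢ leaves S₁ → Far z a
    far-z-a {a} a∈ = far-stable λ ¬far →
      noSource (⁅ a ⁆ ∪ ⁅ x ⁆) ((a , x , leaf-missing a∈ , refl) , λ e l → ¬far (win l (missingEdge⇒ (LosesTo.isMissing l))))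
      where
      a≢x : a ≢ x
      a≢x = leaf≢center S₁ a∈
      win : ∀ {e} → LosesTo e (⁅ a ⁆ ∪ ⁅ x ⁆) → IsEdgeOf S₁ e ⊎ IsEdgeOf S₂ e ⊎ IsEdgeOf S₃ e → Far z a
      win l (inj₁ (a′ , a′∈ , refl)) with losesTo⇒loss (leaf≢center S₁ a′∈) a≢x l
      ... | inj₁ (_ , _ , x⟶x , _) = contradiction x⟶x irrefl
      ... | inj₂ (a′⟶x , _)        = contradiction a′⟶x (proj₁ (proj₂ (leaf-missing a′∈)))
      win l (inj₂ (inj₁ (b , b∈ , refl))) with losesTo⇒loss (leaf≢center S₂ b∈) a≢x l
      ... | inj₁ (_ , _ , y⟶x , _) = contradiction x⟶y (noDigon y⟶x)
      ... | inj₂ (_ , _ , _ , far) = contradiction z⟶x (proj₂ far z y⟶z)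
      win l (inj₂ (inj₂ (c , c∈ , refl))) with losesTo⇒loss (leaf≢center S₃ c∈) a≢x l
      ... | inj₁ (_ , _ , _ , far) = far
      ... | inj₂ (_ , _ , _ , far) = contradiction z⟶x (proj₁ far)

    y⟶a : ∀ {a} → a ∈ˢ leaves S₁ → y ⟶ a
    y⟶a a∈ = towards (Sum.swap (adjacent₁₂ (inj₂ a∈) (inj₁ refl))) (proj₁ (far-a-y a∈))

  open Cyclic hiding (x; y; z)

  module _ {S₁ S₂ S₃ : Star n} (cfg : Config S₁ S₂ S₃) where

    private
      z = center S₃

    a⟶z : ∀ {a} → a ∈ˢ leaves S₁ → a ⟶ z
    a⟶z a∈ = towards (Sum.swap (adjacent₁₂ (rotate (rotate cfg)) (inj₁ refl) (inj₂ a∈))) (proj₁ (far-z-a cfg a∈))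

  module _ {S₁ S₂ S₃ : Star n} (cfg : Config S₁ S₂ S₃) where

    private
      cfg″ = rotate (rotate cfg)
      y = center S₂
      z = center S₃

    -- The opposite arc would give the path a ⟶ c ⟶ y, against `Far a y`.
    c⟶a : ∀ {a c} → a ∈ˢ leaves S₁ → c ∈ˢ leaves S₃ → c ⟶ a
    c⟶a a∈ c∈ = towards (adjacent₁₂ cfg″ (inj₂ c∈) (inj₂ a∈))
      λ a⟶c → proj₂ (far-a-y cfg a∈) _ a⟶c (a⟶z cfg″ c∈)

    -- Since `v` is adjacent to `y`, the alternative is `v ⟶ y`, completing a path of length two
    -- that `Far a y` forbids. `z⇒a` uses `Far z a` likewise.
    a⇒y : ∀ {a v} → ¬ InStars S₁ S₂ S₃ v → a ∈ˢ leaves S₁ → a ⟶ v → y ⟶ v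
    a⇒y v∉ a∈ a⟶v = towards
      (adjacent-outside cfg v∉ λ { refl → v∉ (inj₂ (inj₁ (inj₁ refl))) })
      (proj₂ (far-a-y cfg a∈) _ a⟶v)

    z⇒a : ∀ {a v} → ¬ InStars S₁ S₂ S₃ v → a ∈ˢ leaves S₁ → z ⟶ v → a ⟶ v
    z⇒a v∉ a∈ z⟶v = towards
      (adjacent-outside cfg v∉ λ { refl → v∉ (inj₁ (inj₂ a∈)) })
      (proj₂ (far-z-a cfg a∈) _ z⟶v)

  -- The union of the stars is a module.

  module _ {S₁ S₂ S₃ : Star n} (cfg : Config S₁ S₂ S₃) where

    private
      cfg′ = rotate cfg
      cfg″ = rotate cfg′
      x = center S₁
      y = center S₂
      z = center S₃

    -- One round a ⟶ v ⇒ y ⟶ v ⇒ c ⟶ v ⇒ x ⟶ v ⇒ b ⟶ v ⇒ z ⟶ v ⇒ a ⟶ v makes the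
    -- set of star vertices homogeneous for v.
    module _ {v : Fin n} (v∉ : ¬ InStars S₁ S₂ S₃ v) where

      private
        v∉′ : ¬ InStars S₂ S₃ S₁ v
        v∉′ = v∉ ∘ unrotate-InStars S₁ S₂ S₃
        v∉″ : ¬ InStars S₃ S₁ S₂ v
        v∉″ = v∉′ ∘ unrotate-InStars S₂ S₃ S₁

        c⇒x : ∀ {c} → c ∈ˢ leaves S₃ → c ⟶ v → x ⟶ v
        c⇒x = a⇒y cfg″ v∉″
        y⇒x : y ⟶ v → x ⟶ v
        y⇒x y⟶v = let c , c∈ = Star.nonempty S₃ in c⇒x c∈ (z⇒a cfg″ v∉″ c∈ y⟶v)
        a⇒x : ∀ {a} → a ∈ˢ leaves S₁ → a ⟶ v → x ⟶ v
        a⇒x a∈ = y⇒x ∘ a⇒y cfg v∉ a∈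
        z⇒x : z ⟶ v → x ⟶ v
        z⇒x z⟶v = let a , a∈ = Star.nonempty S₁ in a⇒x a∈ (z⇒a cfg v∉ a∈ z⟶v)

        x⇒b : ∀ {b} → b ∈ˢ leaves S₂ → x ⟶ v → b ⟶ v
        x⇒b = z⇒a cfg′ v∉′
        x⇒z : x ⟶ v → z ⟶ v
        x⇒z x⟶v = let b , b∈ = Star.nonempty S₂ in a⇒y cfg′ v∉′ b∈ (x⇒b b∈ x⟶v)
        x⇒a : ∀ {a} → a ∈ˢ leaves S₁ → x ⟶ v → a ⟶ v
        x⇒a a∈ = z⇒a cfg v∉ a∈ ∘ x⇒z
        x⇒y : x ⟶ v → y ⟶ v
        x⇒y x⟶v = let a , a∈ = Star.nonempty S₁ in a⇒y cfg v∉ a∈ (x⇒a a∈ x⟶v)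

      inStars⇒x : ∀ {k} → InStars S₁ S₂ S₃ k → k ⟶ v → x ⟶ v
      inStars⇒x (inj₁ (inj₁ refl))        = id
      inStars⇒x (inj₁ (inj₂ a∈))          = a⇒x a∈
      inStars⇒x (inj₂ (inj₁ (inj₁ refl))) = y⇒x
      inStars⇒x (inj₂ (inj₁ (inj₂ b∈)))   = z⇒x ∘ a⇒y cfg′ v∉′ b∈
      inStars⇒x (inj₂ (inj₂ (inj₁ refl))) = z⇒x
      inStars⇒x (inj₂ (inj₂ (inj₂ c∈)))   = c⇒x c∈

      x⇒inStars : ∀ {k} → InStars S₁ S₂ S₃ k → x ⟶ v → k ⟶ v
      x⇒inStars (inj₁ (inj₁ refl))        = id
      x⇒inStars (inj₁ (inj₂ a∈))          = x⇒a a∈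
      x⇒inStars (inj₂ (inj₁ (inj₁ refl))) = x⇒y
      x⇒inStars (inj₂ (inj₁ (inj₂ b∈)))   = x⇒b b∈
      x⇒inStars (inj₂ (inj₂ (inj₁ refl))) = x⇒z
      x⇒inStars (inj₂ (inj₂ (inj₂ c∈)))   = z⇒a cfg″ v∉″ c∈ ∘ x⇒y

      inStars-adjacent : ∀ {k} → InStars S₁ S₂ S₃ k → Adj k v
      inStars-adjacent k∈ = adjacent-outside cfg v∉ λ { refl → v∉ k∈ }

      x-into⇒inStars : ∀ {k} → InStars S₁ S₂ S₃ k → v ⟶ x → v ⟶ k
      x-into⇒inStars k∈ v⟶x = towards (Sum.swap (inStars-adjacent k∈))
        λ k⟶v → noDigon v⟶x (inStars⇒x k∈ k⟶v)

      into-inStars⇒x : ∀ {k} → InStars S₁ S₂ S₃ k → v ⟶ k → v ⟶ x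
      into-inStars⇒x k∈ v⟶k = towards (Sum.swap (inStars-adjacent (inj₁ (inj₁ refl))))
        λ x⟶v → noDigon v⟶k (x⇒inStars k∈ x⟶v)

  -- Second neighbourhoods of star vertices.

  -- P contains the out-neighbours and R consists of second out-neighbours,
  -- outside K, of every vertex of K.
  record Outer (K : Pred (Fin n) 0ℓ) (P R : Subset n) : Set where
    field
      exits     : ∀ {k v} → K k → ¬ K v → k ⟶ v → v ∈ˢ P
      seconds   : ∀ {k v} → K k → v ∈ˢ R → ¬ K v × AtDistance2 k v
      ∣P∣≤∣R∣   : ∣ P ∣ ≤ ∣ R ∣

  rotate-Outer : ∀ S₁ S₂ S₃ {P R} → Outer (InStars S₁ S₂ S₃) P R → Outer (InStars S₂ S₃ S₁) P R
  rotate-Outer S₁ S₂ S₃ o = record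
    { exits   = λ k∈ v∉ → exits (back k∈) (v∉ ∘ rotate-InStars S₁ S₂ S₃)
    ; seconds = λ k∈ v∈ → let v∉ , d = seconds (back k∈) v∈ in v∉ ∘ back , d
    ; ∣P∣≤∣R∣ = ∣P∣≤∣R∣
    }
    where
    open Outer o
    back : ∀ {v} → InStars S₂ S₃ S₁ v → InStars S₁ S₂ S₃ v
    back = unrotate-InStars S₁ S₂ S₃

  -- Out-neighbours are covered by three classes, second out-neighbours include three disjoint ones,
  -- and these are compared in pairs: `s` with `t`, `B` with `C`, `P` with `R`. In the uses the
  -- first two pairs lie inside the stars, and `Outer` supplies the third.
  SNP-by-classes : ∀ v {s t} (B C P R : Subset n) →
    (∀ {w} → v ⟶ w → w ≡ s ⊎ w ∈ˢ B ⊎ w ∈ˢ P) →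
    AtDistance2 v t →
    (∀ {w} → w ∈ˢ C → AtDistance2 v w × w ≢ t) →
    (∀ {w} → w ∈ˢ R → AtDistance2 v w × w ≢ t × w ∉ˢ C) →
    ∣ B ∣ ≤ ∣ C ∣ → ∣ P ∣ ≤ ∣ R ∣ → SecondNeighborhoodProperty v
  SNP-by-classes v {s} {t} B C P R exits t₂ C₂ R₂ B≤C P≤R = begin
    ∣ N⁺ v ∣                    ≤⟨ p⊆q⇒∣p∣≤∣q∣ N⁺⊆ ⟩
    ∣ ⁅ s ⁆ ∪ (B ∪ P) ∣         ≤⟨ ∣p∪q∣≤∣p∣+∣q∣ ⁅ s ⁆ (B ∪ P) ⟩
    ∣ ⁅ s ⁆ ∣ + ∣ B ∪ P ∣       ≡⟨ cong (_+ ∣ B ∪ P ∣) (trans (∣⁅x⁆∣≡1 s) (sym (∣⁅x⁆∣≡1 t))) ⟩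
    ∣ ⁅ t ⁆ ∣ + ∣ B ∪ P ∣       ≤⟨ +-mono-≤ (≤-refl {∣ ⁅ t ⁆ ∣}) B∪P≤C∪R ⟩
    ∣ ⁅ t ⁆ ∣ + ∣ C ∪ R ∣       ≤⟨ disjoint⇒∣p∣+∣q∣≤∣p∪q∣ ⁅ t ⁆ (C ∪ R) t∉C∪R ⟩
    ∣ ⁅ t ⁆ ∪ (C ∪ R) ∣         ≤⟨ p⊆q⇒∣p∣≤∣q∣ ⊆N⁺⁺ ⟩
    ∣ N⁺⁺ v ∣                   ∎
    where
    open ≤-Reasoning
    N⁺⊆ : ∀ {w} → w ∈ˢ N⁺ v → w ∈ˢ ⁅ s ⁆ ∪ (B ∪ P)
    N⁺⊆ w∈ = x∈p∪q⁺ (Sum.map (λ { refl → x∈⁅x⁆ _ }) x∈p∪q⁺ (exits (∈⟦⟧⁻ (v ⟶?_) w∈)))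
    ⊆N⁺⁺ : ∀ {w} → w ∈ˢ ⁅ t ⁆ ∪ (C ∪ R) → w ∈ˢ N⁺⁺ v
    ⊆N⁺⁺ w∈ = ∈⟦⟧⁺ (atDistance2? v) (Sum.[ (λ w∈t → subst (AtDistance2 v) (sym (x∈⁅y⁆⇒x≡y t w∈t)) t₂)
      , Sum.[ proj₁ ∘ C₂ , proj₁ ∘ R₂ ] ∘ x∈p∪q⁻ C R ] (x∈p∪q⁻ ⁅ t ⁆ (C ∪ R) w∈))
    t∉C∪R : ∀ {w} → w ∈ˢ ⁅ t ⁆ → w ∉ˢ C ∪ R
    t∉C∪R w∈t w∈ with x∈⁅y⁆⇒x≡y t w∈t | x∈p∪q⁻ C R w∈
    ... | w≡t | inj₁ w∈C = proj₂ (C₂ w∈C) w≡t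
    ... | w≡t | inj₂ w∈R = proj₁ (proj₂ (R₂ w∈R)) w≡t
    B∪P≤C∪R : ∣ B ∪ P ∣ ≤ ∣ C ∪ R ∣
    B∪P≤C∪R = ≤-trans (∣p∪q∣≤∣p∣+∣q∣ B P) (≤-trans (+-mono-≤ B≤C P≤R)
      (disjoint⇒∣p∣+∣q∣≤∣p∪q∣ C R λ w∈C w∈R → proj₂ (proj₂ (R₂ w∈R)) w∈C))

  TwoSNP : Set
  TwoSNP = ∃₂ λ u v → u ≢ v × SecondNeighborhoodProperty u × SecondNeighborhoodProperty v

  module _ {S₁ S₂ S₃ : Star n} (cfg : Config S₁ S₂ S₃) {P R : Subset n}
    (outer : Outer (InStars S₁ S₂ S₃) P R) where

    open Config cfg using (x⟶y; y⟶z; z⟶x)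
    open Outer outer
    private
      cfg′ = rotate cfg
      cfg″ = rotate cfg′
      x = center S₁
      y = center S₂
      z = center S₃
      A = leaves S₁
      B = leaves S₂
      C = leaves S₃
      K = InStars S₁ S₂ S₃

      Kx : K x
      Kx = inj₁ (inj₁ refl)
      Kz : K z
      Kz = inj₂ (inj₂ (inj₁ refl))
      Ka : ∀ {a} → a ∈ˢ A → K a
      Ka a∈ = inj₁ (inj₂ a∈)
      Kc : ∀ {c} → c ∈ˢ C → K c
      Kc c∈ = inj₂ (inj₂ (inj₂ c∈))

      apart : ∀ {k w} → K k → w ∈ˢ R → w ≢ k
      apart k∈ w∈ refl = proj₁ (seconds k∈ w∈) k∈

      second : ∀ {u v} w → v ≢ u → ¬ u ⟶ v → u ⟶ w → w ⟶ v → AtDistance2 u v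
      second w v≢u u↛v u⟶w w⟶v = v≢u , u↛v , w , u⟶w , w⟶v

    -- Inside the stars `z` dominates only `x` and `B`, while `x` leads on to `y` and to all of `C`.
    z-SNP : ∣ B ∣ ≤ ∣ C ∣ → SecondNeighborhoodProperty z
    z-SNP B≤C = SNP-by-classes z B C P R exits-z
      (second x (λ { refl → irrefl y⟶z }) (noDigon y⟶z) z⟶x x⟶y)
      (λ c∈ → let c≢z , _ , z↛c = leaf-missing cfg″ c∈ in
        second x c≢z z↛c z⟶x (y⟶a cfg″ c∈) , λ { refl → irrefl (a⟶z cfg″ c∈) })
      (λ w∈ → proj₂ (seconds Kz w∈) , apart (inj₂ (inj₁ (inj₁ refl))) w∈ , λ w∈C → proj₁ (seconds Kz w∈) (Kc w∈C))
      B≤C ∣P∣≤∣R∣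
      where
      exits-z : ∀ {w} → z ⟶ w → w ≡ x ⊎ w ∈ˢ B ⊎ w ∈ˢ P
      exits-z {w} z⟶w with inStars? S₁ S₂ S₃ w
      ... | no w∉                         = inj₂ (inj₂ (exits Kz w∉ z⟶w))
      ... | yes (inj₁ (inj₁ w≡x))         = inj₁ w≡x
      ... | yes (inj₁ (inj₂ a∈))          = contradiction z⟶w (noDigon (a⟶z cfg a∈))
      ... | yes (inj₂ (inj₁ (inj₁ refl))) = contradiction z⟶w (noDigon y⟶z)
      ... | yes (inj₂ (inj₁ (inj₂ b∈)))   = inj₂ (inj₁ b∈)
      ... | yes (inj₂ (inj₂ (inj₁ refl))) = contradiction z⟶w irrefl
      ... | yes (inj₂ (inj₂ (inj₂ c∈)))   = contradiction z⟶w (proj₂ (proj₂ (leaf-missing cfg″ c∈)))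

    private
      -- Every missing edge contains a center, so the leaves of one star form a tournament; unit
      -- weights give the ordinary property.
      module M = MedianOrder _⟶?_ noDigon (λ _ → 1) (λ _ → s≤s z≤n)

      As = filter (_∈? A) (allFin n)

      tournament : AllPairs M.Adjacent As
      tournament = unique⇒allPairs (adjacent-leaves cfg) (All.all-filter (_∈? A) (allFin n))
        (Unique.filter⁺ (_∈? A) (Unique.allFin⁺ n))

      via? = M.second? As tournament

      leafOut? : ∀ a → Decidable λ w → w ∈ˢ A × a ⟶ w
      leafOut? a w = (w ∈? A) ×-dec (a ⟶? w)

      leafSecond? : ∀ a → Decidable λ w → w ∈ˢ A × M.Second As tournament a w
      leafSecond? a w = (w ∈? A) ×-dec via? a w

      N⁺ᴬ N⁺⁺ᴬ : Fin n → Subset n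
      N⁺ᴬ a  = ⟦ leafOut? a ⟧
      N⁺⁺ᴬ a = ⟦ leafSecond? a ⟧

      SNPᴬ : ∀ {a} → M.SNP As tournament a → ∣ N⁺ᴬ a ∣ ≤ ∣ N⁺⁺ᴬ a ∣
      SNPᴬ {a} = subst₂ _≤_
        (total-filter id (_∈? A) (leafOut? a) _
          (λ {w} w∈ → trans (*-identityʳ _) (𝟙-cong (a ⟶? w) (leafOut? a w) (w∈ ,_) proj₂)) proj₁)
        (total-filter id (_∈? A) (leafSecond? a) _
          (λ {w} w∈ → trans (*-identityʳ _) (𝟙-cong (via? a w) (leafSecond? a w) (w∈ ,_) proj₂)) proj₁)

    -- Inside the stars `a` dominates `z`, `B` and its out-neighbours in `A`. It reaches `x` through
    -- `z`, all of `C` through any leaf `b`, and its second out-neighbours in `A`.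
    a-SNP : ∀ {a} → a ∈ˢ A → ∣ N⁺ᴬ a ∣ ≤ ∣ N⁺⁺ᴬ a ∣ → ∣ B ∣ ≤ ∣ C ∣ → SecondNeighborhoodProperty a
    a-SNP {a} a∈ le B≤C = SNP-by-classes a (B ∪ N⁺ᴬ a) (C ∪ N⁺⁺ᴬ a) P R exits-a
      (let a≢x , a↛x , _ = leaf-missing cfg a∈ in second z (a≢x ∘ sym) a↛x (a⟶z cfg a∈) z⟶x)
      (Sum.[ C₂ , A₂ ] ∘ x∈p∪q⁻ C (N⁺⁺ᴬ a))
      (λ w∈ → proj₂ (seconds (Ka a∈) w∈) , apart Kx w∈ ,
        λ w∈′ → proj₁ (seconds Kx w∈) (Sum.[ Kc , (λ w∈″ → Ka (proj₁ (∈⟦⟧⁻ (leafSecond? a) w∈″))) ] (x∈p∪q⁻ C (N⁺⁺ᴬ a) w∈′)))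
      (≤-trans (∣p∪q∣≤∣p∣+∣q∣ B (N⁺ᴬ a)) (≤-trans (+-mono-≤ B≤C le)
        (disjoint⇒∣p∣+∣q∣≤∣p∪q∣ C (N⁺⁺ᴬ a) λ c∈ w∈ → irrefl (c⟶a cfg (proj₁ (∈⟦⟧⁻ (leafSecond? a) w∈)) c∈))))
      ∣P∣≤∣R∣
      where
      exits-a : ∀ {w} → a ⟶ w → w ≡ z ⊎ w ∈ˢ B ∪ N⁺ᴬ a ⊎ w ∈ˢ P
      exits-a {w} a⟶w with inStars? S₁ S₂ S₃ w
      ... | no w∉                         = inj₂ (inj₂ (exits (Ka a∈) w∉ a⟶w))
      ... | yes (inj₁ (inj₁ refl))        = contradiction a⟶w (proj₁ (proj₂ (leaf-missing cfg a∈)))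
      ... | yes (inj₁ (inj₂ w∈))          = inj₂ (inj₁ (x∈p∪q⁺ (inj₂ (∈⟦⟧⁺ (leafOut? a) (w∈ , a⟶w)))))
      ... | yes (inj₂ (inj₁ (inj₁ refl))) = contradiction a⟶w (noDigon (y⟶a cfg a∈))
      ... | yes (inj₂ (inj₁ (inj₂ b∈)))   = inj₂ (inj₁ (x∈p∪q⁺ (inj₁ b∈)))
      ... | yes (inj₂ (inj₂ (inj₁ w≡z)))  = inj₁ w≡z
      ... | yes (inj₂ (inj₂ (inj₂ c∈)))   = contradiction a⟶w (noDigon (c⟶a cfg a∈ c∈))

      C₂ : ∀ {w} → w ∈ˢ C → AtDistance2 a w × w ≢ x
      C₂ c∈ = let b , b∈ = Star.nonempty S₂ in
        second b (λ { refl → irrefl (c⟶a cfg a∈ c∈) }) (noDigon (c⟶a cfg a∈ c∈))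
          (c⟶a cfg′ b∈ a∈) (c⟶a cfg″ c∈ b∈) ,
        λ { refl → irrefl (y⟶a cfg″ c∈) }

      A₂ : ∀ {w} → w ∈ˢ N⁺⁺ᴬ a → AtDistance2 a w × w ≢ x
      A₂ w∈ = let w∈A , w⟶a , via = ∈⟦⟧⁻ (leafSecond? a) w∈
                  u , _ , a⟶u , u⟶w = find via in
        second u (λ { refl → irrefl w⟶a }) (noDigon w⟶a) a⟶u u⟶w , leaf≢center cfg S₁ w∈A

    ¬¬-two-SNP-in-stars : ∣ B ∣ ≤ ∣ C ∣ → ¬ ¬ TwoSNP
    ¬¬-two-SNP-in-stars B≤C none =
      M.¬¬-SNP As tournament (∈-filter⁺ (_∈? A) (∈-allFin a₀) a₀∈) λ (a , a∈As , snp) →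
        let a∈ = proj₂ (∈-filter⁻ (_∈? A) {xs = allFin n} a∈As) in
        none (z , a , (λ { refl → irrefl (a⟶z cfg a∈) }) , z-SNP B≤C , a-SNP a∈ (SNPᴬ snp) B≤C)
      where
      a₀  = proj₁ (Star.nonempty S₁)
      a₀∈ = proj₂ (Star.nonempty S₁)

  -- Around a cycle of three numbers, some step does not decrease; rotation brings that step to |B|
  -- ≤ |C|.
  ¬¬-two-SNP-if-outer : ∀ {S₁ S₂ S₃ P R} → Config S₁ S₂ S₃ → Outer (InStars S₁ S₂ S₃) P R → ¬ ¬ TwoSNP
  ¬¬-two-SNP-if-outer {S₁} {S₂} {S₃} cfg outer
    with ≤-total ∣ leaves S₂ ∣ ∣ leaves S₃ ∣ | ≤-total ∣ leaves S₃ ∣ ∣ leaves S₁ ∣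
  ... | inj₁ B≤C | _        = ¬¬-two-SNP-in-stars cfg outer B≤C
  ... | inj₂ _   | inj₁ C≤A = ¬¬-two-SNP-in-stars (rotate cfg) (rotate-Outer S₁ S₂ S₃ outer) C≤A
  ... | inj₂ C≤B | inj₂ A≤C = ¬¬-two-SNP-in-stars (rotate (rotate cfg))
    (rotate-Outer S₂ S₃ S₁ (rotate-Outer S₁ S₂ S₃ outer)) (≤-trans A≤C C≤B)

  -- The tournament obtained by contracting the stars.

  module _ {S₁ S₂ S₃ : Star n} (cfg : Config S₁ S₂ S₃) (no-sink : ∀ v → ¬ Digraph.IsSink digraph v) where

    private
      x = center S₁
      K = InStars S₁ S₂ S₃
      K? = inStars? S₁ S₂ S₃

      Kx : K x
      Kx = inj₁ (inj₁ refl)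

      -- The star vertices are contracted to x.
      ω : Fin n → ℕ
      ω v = if does (v ≟ x) then ∣ ⟦ K? ⟧ ∣ else 1

      ω-x : ω x ≡ ∣ ⟦ K? ⟧ ∣
      ω-x with x ≟ x
      ... | yes _  = refl
      ... | no x≢x = contradiction refl x≢x

      ω-outside : ∀ {v} → ¬ K v → ω v ≡ 1
      ω-outside {v} v∉ with v ≟ x
      ... | yes refl = contradiction Kx v∉
      ... | no _     = refl

      ω>0 : ∀ v → 0 < ω v
      ω>0 v with v ≟ x
      ... | no _  = ≤-refl
      ... | yes _ = ≤-trans (≤-reflexive (sym (∣⁅x⁆∣≡1 x)))
        (p⊆q⇒∣p∣≤∣q∣ λ {w} w∈ → subst (_∈ˢ ⟦ K? ⟧) (sym (x∈⁅y⁆⇒x≡y x w∈)) (∈⟦⟧⁺ K? Kx))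

      module M = MedianOrder _⟶?_ noDigon ω ω>0

      O? : Decidable (¬_ ∘ K)
      O? = ¬? ∘ K?

      Os S : List (Fin n)
      Os = filter O? (allFin n)
      S = x ∷ Os

      ∈Os : ∀ {v} → ¬ K v → v ∈ S
      ∈Os v∉ = there (∈-filter⁺ O? (∈-allFin _) v∉)

      ∈S⇒ : ∀ {v} → v ∈ S → v ≡ x ⊎ ¬ K v
      ∈S⇒ (here v≡x) = inj₁ v≡x
      ∈S⇒ (there v∈) = inj₂ (proj₂ (∈-filter⁻ O? {xs = allFin n} v∈))

      tournament : AllPairs M.Adjacent S
      tournament =
        All.map (λ v∉ → inStars-adjacent cfg v∉ Kx) (All.all-filter O? (allFin n)) ∷
        unique⇒allPairs (λ _ → adjacent-outside cfg) (All.all-filter O? (allFin n))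
          (Unique.filter⁺ O? (Unique.allFin⁺ n))

      Second = M.Second S tournament
      second? = M.second? S tournament

      outerOut? : ∀ v → Decidable λ w → ¬ K w × v ⟶ w
      outerOut? v w = O? w ×-dec (v ⟶? w)

      outerSecond? : ∀ v → Decidable λ w → ¬ K w × Second v w
      outerSecond? v w = O? w ×-dec second? v w

      quotient-total : ∀ {P : Pred (Fin n) 0ℓ} (P? : Decidable P) →
        total (λ w → 𝟙 (P? w) * ω w) S ≡ 𝟙 (P? x) * ∣ ⟦ K? ⟧ ∣ + ∣ ⟦ (λ w → O? w ×-dec P? w) ⟧ ∣
      quotient-total P? = cong₂ _+_ (cong (𝟙 (P? x) *_) ω-x)
        (total-filter id O? (λ w → O? w ×-dec P? w) _
          (λ {w} w∉ → trans (cong (𝟙 (P? w) *_) (ω-outside w∉))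
            (trans (*-identityʳ _) (𝟙-cong (P? w) (O? w ×-dec P? w) (w∉ ,_) proj₂)))
          proj₁)

      quotient-SNP : ∀ {v} → M.SNP S tournament v →
        𝟙 (v ⟶? x) * ∣ ⟦ K? ⟧ ∣ + ∣ ⟦ outerOut? v ⟧ ∣ ≤
        𝟙 (second? v x) * ∣ ⟦ K? ⟧ ∣ + ∣ ⟦ outerSecond? v ⟧ ∣
      quotient-SNP {v} = subst₂ _≤_ (quotient-total (v ⟶?_)) (quotient-total (second? v))

      second-through : ∀ {v w} → Second v w → w ⟶ v × ∃ λ u → (u ≡ x ⊎ ¬ K u) × v ⟶ u × u ⟶ w
      second-through (w⟶v , via) = let u , u∈ , v⟶u , u⟶w = find via in w⟶v , u , ∈S⇒ u∈ , v⟶u , u⟶w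

      -- The vertex `x` is neither an out-neighbour nor a second out-neighbour of itself, so both
      -- heavy terms vanish and only outside vertices are compared. Homogeneity carries their arcs
      -- from `x` over to every star vertex.
      outer : M.SNP S tournament x → Outer K ⟦ outerOut? x ⟧ ⟦ outerSecond? x ⟧
      outer snp = record
        { exits   = λ k∈ v∉ k⟶v → ∈⟦⟧⁺ (outerOut? x) (v∉ , inStars⇒x cfg v∉ k∈ k⟶v)
        ; seconds = λ k∈ v∈ → let v∉ , s = ∈⟦⟧⁻ (outerSecond? x) v∈ in v∉ , distance2 k∈ v∉ (second-through s)
        ; ∣P∣≤∣R∣ = subst₂ (λ s t → s * ∣ ⟦ K? ⟧ ∣ + ∣ ⟦ outerOut? x ⟧ ∣ ≤ t * ∣ ⟦ K? ⟧ ∣ + ∣ ⟦ outerSecond? x ⟧ ∣)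
            (𝟙-false (x ⟶? x) irrefl) (𝟙-false (second? x x) (irrefl ∘ proj₁)) (quotient-SNP snp)
        }
        where
        distance2 : ∀ {k v} → K k → ¬ K v → v ⟶ x × (∃ λ u → (u ≡ x ⊎ ¬ K u) × x ⟶ u × u ⟶ v) → AtDistance2 k v
        distance2 k∈ v∉ (v⟶x , u , inj₁ refl , x⟶u , _)  = contradiction x⟶u irrefl
        distance2 k∈ v∉ (v⟶x , u , inj₂ u∉ , x⟶u , u⟶v) =
          (λ { refl → v∉ k∈ }) , noDigon (x-into⇒inStars cfg v∉ k∈ v⟶x) ,
          u , x⇒inStars cfg u∉ k∈ x⟶u , u⟶v

      -- The weight of `x` stands for the whole of `K`, and `v` sees all of `K` as it sees `x`;
      -- hence the weighted out-degree bounds `d⁺ v` from above and the weighted second one bounds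
      -- `d⁺⁺ v` from below.
      lift-SNP : ∀ {v} → ¬ K v → M.SNP S tournament v → SecondNeighborhoodProperty v
      lift-SNP {v} v∉ snp = ≤-trans (out≤ (v ⟶? x)) (≤-trans (quotient-SNP snp) (≤second (second? v x)))
        where
        out≤ : (d : Dec (v ⟶ x)) → ∣ N⁺ v ∣ ≤ 𝟙 d * ∣ ⟦ K? ⟧ ∣ + ∣ ⟦ outerOut? v ⟧ ∣
        out≤ (no v↛x) = p⊆q⇒∣p∣≤∣q∣ λ w∈ → ∈⟦⟧⁺ (outerOut? v)
          ((λ Kw → v↛x (into-inStars⇒x cfg v∉ Kw (∈⟦⟧⁻ (v ⟶?_) w∈))) , ∈⟦⟧⁻ (v ⟶?_) w∈)
        out≤ (yes _) rewrite +-identityʳ ∣ ⟦ K? ⟧ ∣ =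
          ≤-trans (p⊆q⇒∣p∣≤∣q∣ split) (∣p∪q∣≤∣p∣+∣q∣ ⟦ K? ⟧ ⟦ outerOut? v ⟧)
          where
          split : ∀ {w} → w ∈ˢ N⁺ v → w ∈ˢ ⟦ K? ⟧ ∪ ⟦ outerOut? v ⟧
          split {w} w∈ with K? w
          ... | yes Kw = x∈p∪q⁺ (inj₁ (∈⟦⟧⁺ K? Kw))
          ... | no w∉  = x∈p∪q⁺ (inj₂ (∈⟦⟧⁺ (outerOut? v) (w∉ , ∈⟦⟧⁻ (v ⟶?_) w∈)))

        outer⊆ : ∀ {w} → w ∈ˢ ⟦ outerSecond? v ⟧ → w ∈ˢ N⁺⁺ v
        outer⊆ w∈ = let _ , s = ∈⟦⟧⁻ (outerSecond? v) w∈
                        w⟶v , u , _ , v⟶u , u⟶w = second-through s in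
          ∈⟦⟧⁺ (atDistance2? v) ((λ { refl → irrefl w⟶v }) , noDigon w⟶v , u , v⟶u , u⟶w)

        inner⊆ : Second v x → ∀ {w} → K w → w ∈ˢ N⁺⁺ v
        inner⊆ s Kw with second-through s
        ... | x⟶v , u , inj₁ refl , v⟶u , u⟶x = contradiction u⟶x irrefl
        -- The intermediate `u` lies outside the stars, so its arc into `x` extends to all of `K`.
        ... | x⟶v , u , inj₂ u∉ , v⟶u , u⟶x = ∈⟦⟧⁺ (atDistance2? v)
          ((λ { refl → v∉ Kw }) , noDigon (x⇒inStars cfg v∉ Kw x⟶v) , u , v⟶u , x-into⇒inStars cfg u∉ Kw u⟶x)

        ≤second : (d : Dec (Second v x)) → 𝟙 d * ∣ ⟦ K? ⟧ ∣ + ∣ ⟦ outerSecond? v ⟧ ∣ ≤ ∣ N⁺⁺ v ∣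
        ≤second (no _)  = p⊆q⇒∣p∣≤∣q∣ outer⊆
        ≤second (yes s) rewrite +-identityʳ ∣ ⟦ K? ⟧ ∣ =
          ≤-trans (disjoint⇒∣p∣+∣q∣≤∣p∪q∣ ⟦ K? ⟧ ⟦ outerSecond? v ⟧
                    (λ w∈K w∈ → proj₁ (∈⟦⟧⁻ (outerSecond? v) w∈) (∈⟦⟧⁻ K? w∈K)))
            (p⊆q⇒∣p∣≤∣q∣ λ w∈ → Sum.[ (λ w∈K → inner⊆ s (∈⟦⟧⁻ K? w∈K)) , outer⊆ ]
              (x∈p∪q⁻ ⟦ K? ⟧ ⟦ outerSecond? v ⟧ w∈))

      has-out : ∀ v → ∃ λ w → v ⟶ w
      has-out v = decidable-stable (anyFin? (v ⟶?_)) λ none → no-sink v (_ , λ w l → none (w , l))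

      no-sink-in-quotient : ∀ {v} → ¬ K v → Any (v ⟶_) S
      no-sink-in-quotient {v} v∉ with has-out v
      ... | w , v⟶w with K? w
      ...   | yes Kw = here (into-inStars⇒x cfg v∉ Kw v⟶w)
      ...   | no w∉  = Any.map (λ { refl → v⟶w }) (∈Os w∉)

    -- If the heavy vertex turns up as the first or the second vertex, the stars alone provide two;
    -- otherwise both are light and lift to `D`.
    ¬¬-TwoSNP : ¬ ¬ TwoSNP
    ¬¬-TwoSNP none = M.¬¬-two-SNP S tournament (here refl) conclude
      where
      ¬x-SNP : ¬ M.SNP S tournament x
      ¬x-SNP snp = ¬¬-two-SNP-if-outer cfg (outer snp) none

      conclude : ¬ ∃ λ v → v ∈ S × M.SNP S tournament v ×
        (ω v ≡ 1 → Any (v ⟶_) S → ∃ λ w → w ≢ v × w ∈ S × M.SNP S tournament w)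
      conclude (v , v∈ , snp , other) with ∈S⇒ v∈
      ... | inj₁ refl = ¬x-SNP snp
      ... | inj₂ v∉ with other (ω-outside v∉) (no-sink-in-quotient v∉)
      ...   | w , w≢v , w∈ , snp′ with ∈S⇒ w∈
      ...     | inj₁ refl = ¬x-SNP snp′
      ...     | inj₂ w∉   = none (v , w , w≢v ∘ sym , lift-SNP v∉ snp , lift-SNP w∉ snp′)

theorem7 : ∀ {n : ℕ} (D : OrientedGraph n) (S₁ S₂ S₃ : Star n) →
    let open OrientedGraph D in
    MissingThreeDisjointStars S₁ S₂ S₃ →
    DirectedTriangle (Star.center S₁) (Star.center S₂) (Star.center S₃) →
    (∀ e → ¬ Digraph.IsSource Δ e) →
    (∀ e → ¬ Digraph.IsSink Δ e) →
    (∀ v → ¬ Digraph.IsSink digraph v) →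
    ∃₂ λ u v → u ≢ v × SecondNeighborhoodProperty u × SecondNeighborhoodProperty v
theorem7 D S₁ S₂ S₃ missing triangle noSource noSink no-sink =
  decidable-stable two? (conclude triangle)
  where
  open OrientedGraph D
  two? : Dec (TwoSNP D)
  two? = anyFin? λ u → anyFin? λ v → ¬? (u ≟ v) ×-dec (d⁺ u ≤? d⁺⁺ u) ×-dec (d⁺ v ≤? d⁺⁺ v)
  conclude : DirectedTriangle (Star.center S₁) (Star.center S₂) (Star.center S₃) → ¬ ¬ TwoSNP D
  conclude (inj₁ (x⟶y , y⟶z , z⟶x)) = ¬¬-TwoSNP D {S₁} {S₂} {S₃} (record
    { missing = missing ; x⟶y = x⟶y ; y⟶z = y⟶z ; z⟶x = z⟶x ; noSource = noSource ; noSink = noSink }) no-sink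
  -- Exchanging the second and third stars turns the reversed triangle into the orientation of
  -- `Config`.
  conclude (inj₂ (x⟶z , z⟶y , y⟶x)) = ¬¬-TwoSNP D {S₁} {S₃} {S₂} (record
    { missing = record
      { disjoint₁₂ = disjoint₁₃
      ; disjoint₁₃ = disjoint₁₂
      ; disjoint₂₃ = λ (p , q) → disjoint₂₃ (q , p)
      ; union = let (V⊆ , V⊇) , E⊆ , E⊇ = union in
          (Sum.map id Sum.swap ∘ V⊆ , V⊇ ∘ Sum.map id Sum.swap) ,
          Sum.map id Sum.swap ∘ E⊆ , E⊇ ∘ Sum.map id Sum.swap
      }
    ; x⟶y = x⟶z ; y⟶z = z⟶y ; z⟶x = y⟶x ; noSource = noSource ; noSink = noSink }) no-sink
    where open MissingThreeDisjointStars missing
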